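{- Let $k\ge2$, $\rho\ge1$ with $\rho<m/(k-1)$, and let $\mathcal{C}$ be a non-degenerate $[m+\rho,k]_{q^m/q}$ code such that $\mathcal{C}^\perp$ is non-degenerate, with associated system $U_{\mathcal{C}}\subseteq\mathbb{F}_{q^m}^k$. Then $\mathcal{C}$ is quasi-MRD if and only if $\varepsilon_{U_{\mathcal{C}}}(k-1)=\rho$; $\mathcal{C}^\perp$ is quasi-MRD if and only if $U_{\mathcal{C}}$ is $(k-2)$-scattered. Hence $\mathcal{C}$ is dually quasi-MRD if and only if $U_{\mathcal{C}}$ is $(k-2)$-scattered and $\varepsilon_{U_{\mathcal{C}}}(k-1)=\rho$.
   Context: An $[n,k]_{q^m/q}$ code is a $k$-dim $\mathbb{F}_{q^m}$-subspace of $\mathbb{F}_{q^m}^n$ with the rank metric (rank weight of $v$ is $\dim_{\mathbb{F}_q}\langle v_1,\dots,v_n\rangle_{\mathbb{F}_q}$); $\mathcal{C}^\perp$ is the dual w.r.t. the standard bilinear form. Non-degenerate: columns of a generator matrix are $\mathbb{F}_q$-linearly independent; $U_{\mathcal{C}}$ is the $\mathbb{F}_q$-span of these columns. For $n>m$ with $n\nmid mk$, an $[n,k]_{q^m/q}$ code is quasi-MRD if its minimum distance is $m-\lceil km/n\rceil+1$; $\mathcal{C}$ is dually quasi-MRD if $\mathcal{C}$ and $\mathcal{C}^\perp$ are both quasi-MRD. For an $\mathbb{F}_q$-subspace $U$ of $\mathbb{F}_{q^m}^k$: $\varepsilon_U(T)=\dim_{\mathbb{F}_q}(U\cap T)-\dim_{\mathbb{F}_{q^m}}T$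 and $\varepsilon_U(r)=\max\{\varepsilon_U(T):\dim_{\mathbb{F}_{q^m}}T=r\}$. $U$ is $h$-scattered if $\dim_{\mathbb{F}_q}(U\cap T)\le h$ for all $h$-dimensional $\mathbb{F}_{q^m}$-subspaces $T$ (vacuous for $h=0$). -}

module Defs where

open import Level using (0ℓ)
open import Algebra.Bundles using (CommutativeRing)
open import Data.Nat as ℕ using (ℕ; zero; suc)
open import Data.Nat.Divisibility using (_∣_)
open import Data.Integer as ℤ using (ℤ; +_)
open import Data.Fin using (Fin; zero; suc)
open import Data.Product using (Σ; ∃; ∃₂; _×_; _,_)
open import Data.Unit using (⊤)
open import Function using (_∘_)
open import Relation.Nullary using (¬_)
open import Relation.Unary using (Pred; _∩_)
open import Relation.Binary.PropositionalEquality using (_≡_)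
open import Relation.Binary using (Decidable)

record Field : Set₁ where
  field
    commRing : CommutativeRing 0ℓ 0ℓ
  open CommutativeRing commRing public
    using (Carrier; _≈_; _+_; _*_; -_; 0#; 1#)
  field
    _≟_     : Decidable _≈_
    0≉1     : ¬ (0# ≈ 1#)
    inverse : ∀ x → ¬ (x ≈ 0#) → ∃ λ y → x * y ≈ 1#

-- ceiling division ⌈ a / n ⌉ (n > 0; value 0 for n = 0, never used)
⌈_/_⌉ : ℕ → ℕ → ℕ
⌈ a / zero ⌉  = 0
⌈ a / suc n ⌉ = (a ℕ.+ n) ℕ./ suc n

module Over (F : Field) where
  open Field F using (Carrier; _≈_; _+_; _*_; -_; 0#; 1#)

  -- A finite subfield K of L = Carrier (playing F_q inside F_{q^m}).
  record Subfield : Set₁ where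
    field
      In         : Carrier → Set
      resp       : ∀ {x y} → x ≈ y → In x → In y
      has0       : In 0#
      has1       : In 1#
      +-closed   : ∀ {x y} → In x → In y → In (x + y)
      neg-closed : ∀ {x} → In x → In (- x)
      *-closed   : ∀ {x y} → In x → In y → In (x * y)
      inv-closed : ∀ {x y} → In x → x * y ≈ 1# → In y
      finite     : ∃₂ λ (q : ℕ) (enum : Fin q → Carrier) →
                     (∀ i → In (enum i)) × (∀ x → In x → ∃ λ i → x ≈ enum i)

  record Space : Set₁ where
    field
      V    : Set
      _≈V_ : V → V → Set
      0V   : V
      _+V_ : V → V → V
      _·V_ : Carrier → V → V

  Lsp : Space
  Lsp = record { V = Carrier ; _≈V_ = _≈_ ; 0V = 0# ; _+V_ = _+_ ; _·V_ = _*_ }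

  Vsp : ℕ → Space
  Vsp t = record
    { V = Fin t → Carrier
    ; _≈V_ = λ x y → ∀ j → x j ≈ y j
    ; 0V = λ _ → 0#
    ; _+V_ = λ x y j → x j + y j
    ; _·V_ = λ c x j → c * x j }

  AllL : Carrier → Set
  AllL _ = ⊤

  module _ (S : Space) where
    open Space S

    lincomb : ∀ {d} → (Fin d → Carrier) → (Fin d → V) → V
    lincomb {zero}  c v = 0V
    lincomb {suc d} c v = (c zero ·V v zero) +V lincomb (c ∘ suc) (v ∘ suc)

    LinIndep : (P : Carrier → Set) → ∀ {d} → (Fin d → V) → Set
    LinIndep P {d} v = (c : Fin d → Carrier) → (∀ i → P (c i)) →
                       lincomb c v ≈V 0V → ∀ i → c i ≈ 0#

    Span : (P : Carrier → Set) → ∀ {d} → (Fin d → V) → Pred V 0ℓ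
    Span P {d} v x = ∃ λ (c : Fin d → Carrier) → (∀ i → P (c i)) × x ≈V lincomb c v

    IsSubspace : (P : Carrier → Set) → Pred V 0ℓ → Set
    IsSubspace P W =
      W 0V × (∀ {x y} → W x → W y → W (x +V y)) ×
      (∀ {c x} → P c → W x → W (c ·V x)) × (∀ {x y} → x ≈V y → W x → W y)

    HasIndep : (P : Carrier → Set) → Pred V 0ℓ → ℕ → Set
    HasIndep P W d = ∃ λ (v : Fin d → V) → (∀ i → W (v i)) × LinIndep P v

    DimLe : (P : Carrier → Set) → Pred V 0ℓ → ℕ → Set
    DimLe P W d = ¬ HasIndep P W (suc d)

    HasDim : (P : Carrier → Set) → Pred V 0ℓ → ℕ → Set
    HasDim P W d = HasIndep P W d × DimLe P W d

  module Codes (K : Subfield) (m : ℕ) where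
    open Subfield K using (In)

    IsDegree : Set
    IsDegree = HasDim Lsp In (λ _ → ⊤) m

    HasRankWeight : ∀ {n} → (Fin n → Carrier) → ℕ → Set
    HasRankWeight v w = HasDim Lsp In (Span Lsp In v) w

    NonZero : ∀ {n} → (Fin n → Carrier) → Set
    NonZero {n} c = ¬ (∀ j → c j ≈ 0#)

    HasMinDist : ∀ {n} → Pred (Fin n → Carrier) 0ℓ → ℕ → Set
    HasMinDist C d =
      (∃ λ c → C c × NonZero c × HasRankWeight c d) ×
      (∀ c w → C c → NonZero c → HasRankWeight c w → d ℕ.≤ w)

    Code : ∀ {k n} → (Fin k → Fin n → Carrier) → Pred (Fin n → Carrier) 0ℓ
    Code {k} {n} G = Span (Vsp n) AllL G

    IsGeneratorMatrix : ∀ {k n} → Pred (Fin n → Carrier) 0ℓ →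
                        (Fin k → Fin n → Carrier) → Set
    IsGeneratorMatrix {k} {n} C G =
      LinIndep (Vsp n) AllL G × (∀ x → C x → Code G x) × (∀ x → Code G x → C x)

    ColumnsIndepK : ∀ {k n} → (Fin k → Fin n → Carrier) → Set
    ColumnsIndepK {k} {n} G = LinIndep (Vsp k) In (λ j i → G i j)

    NonDegenerate : ∀ {n} → Pred (Fin n → Carrier) 0ℓ → ℕ → Set
    NonDegenerate {n} C k =
      ∃ λ (G : Fin k → Fin n → Carrier) → IsGeneratorMatrix C G × ColumnsIndepK G

    dot : ∀ {n} → (Fin n → Carrier) → (Fin n → Carrier) → Carrier
    dot x y = lincomb Lsp x y

    Dual : ∀ {n} → Pred (Fin n → Carrier) 0ℓ → Pred (Fin n → Carrier) 0ℓ
    Dual C x = ∀ c → C c → dot c x ≈ 0#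

    QuasiMRD : ∀ {n} → Pred (Fin n → Carrier) 0ℓ → ℕ → Set
    QuasiMRD {n} C k =
      m ℕ.< n × ¬ (n ∣ m ℕ.* k) × HasMinDist C ((m ℕ.∸ ⌈ k ℕ.* m / n ⌉) ℕ.+ 1)

    DuallyQuasiMRD : ∀ {n} → Pred (Fin n → Carrier) 0ℓ → ℕ → Set
    DuallyQuasiMRD {n} C k = QuasiMRD C k × QuasiMRD (Dual C) (n ℕ.∸ k)

    System : ∀ {k n} → (Fin k → Fin n → Carrier) → Pred (Fin k → Carrier) 0ℓ
    System {k} {n} G = Span (Vsp k) In (λ j i → G i j)

    IsEpsT : ∀ {k} → Pred (Fin k → Carrier) 0ℓ → Pred (Fin k → Carrier) 0ℓ → ℤ → Set
    IsEpsT {k} U T e = ∃₂ λ a b →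
      HasDim (Vsp k) In (U ∩ T) a × HasDim (Vsp k) AllL T b × e ≡ (+ a) ℤ.- (+ b)

    IsEps : ∀ {k} → Pred (Fin k → Carrier) 0ℓ → ℕ → ℤ → Set₁
    IsEps {k} U r e =
      (∃ λ (T : Pred (Fin k → Carrier) 0ℓ) →
         IsSubspace (Vsp k) AllL T × HasDim (Vsp k) AllL T r × IsEpsT U T e) ×
      (∀ (T : Pred (Fin k → Carrier) 0ℓ) → IsSubspace (Vsp k) AllL T →
         HasDim (Vsp k) AllL T r → ∀ e' → IsEpsT U T e' → e' ℤ.≤ e)

    Scattered : ∀ {k} → Pred (Fin k → Carrier) 0ℓ → ℕ → Set₁
    Scattered {k} U h =
      ∀ (T : Pred (Fin k → Carrier) 0ℓ) → IsSubspace (Vsp k) AllL T →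
        HasDim (Vsp k) AllL T h → DimLe (Vsp k) In (U ∩ T) h

{-# OPTIONS --safe #-}

-- Write n = m + ρ and U = U_C. The hypothesis ρ(k-1) < m gives 0 < kρ < n, so that ⌈km/n⌉ = k and
-- ⌈(n-k)m/n⌉ = m-k+1: the quasi-MRD distances of C and of its dual are m-k+1 and k.
-- Every hyperplane of L^k is x^⊥ for some x ≠ 0, and rank-nullity for the K-linear map
-- K^n → L given by the codeword xG yields wt(xG) = n - dim_K(U ∩ x^⊥); this is the first equivalence.
-- For the dual, a rank factorisation y = Σ αᵢ λᵢ (αᵢ ∈ L and λᵢ ∈ K^n both K-independent) turns a
-- codeword of weight w into w K-independent vectors Gλᵢ of U with the L-linear relation Σ αᵢ Gλᵢ = 0,
-- and conversely; so the dual distance is at least k iff any k-1 K-independent vectors of U are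
-- L-independent, i.e. iff U is (k-2)-scattered. It is never more than k: the vectors with entries in
-- a k-dimensional K-subspace of L form a K-space of dimension nk > km, and being orthogonal to C
-- imposes km conditions over K.
-- L is finite, so that dependence and membership in spans are decidable over K and over L.

module Submission where

open import Defs
open import Algebra.Bundles using (CommutativeRing)
import Algebra.Properties.Ring
open import Data.Empty using (⊥-elim)
open import Data.Fin as Fin using (Fin; zero; suc)
import Data.Fin.Properties as Fin
open import Data.Integer as ℤ using (+_)
import Data.Integer.Properties as ℤ
open import Data.Nat as ℕ using (ℕ; zero; suc)
open import Data.Nat.DivMod using (+-distrib-/-∣ʳ; m<n⇒m/n≡0; m*n/n≡m)
open import Data.Nat.Divisibility using (_∣_; ∣m+n∣m⇒∣n; ∣⇒≤; n∣m*n)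
import Data.Nat.Properties as ℕ
open import Data.Nat.Tactic.RingSolver using (solve-∀)
open import Data.Product using (∃; _×_; _,_; proj₁; proj₂)
open import Data.Unit using (⊤; tt)
open import Data.Vec.Functional using (_∷_)
open import Function using (_∘_)
open import Function.Bundles using (_⇔_; mk⇔; Equivalence)
open import Level using (0ℓ)
open import Relation.Binary using (Setoid; IsEquivalence; Decidable)
open import Relation.Binary.PropositionalEquality as ≡ using (_≡_)
import Relation.Binary.Reasoning.Setoid as SetoidReasoning
open import Relation.Nullary using (¬_; Dec; yes; no)
open import Relation.Nullary.Decidable using (map′; ¬?; _×-dec_)
open import Relation.Unary using (Pred; _⊆_; _∩_)

-- Vector spaces over L and identities for linear combinations.

module VectorSpaces (F : Field) where
  open Over F
  open Field F using (commRing; _≟_)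
  open CommutativeRing commRing hiding (zero)

  -- Scalars range over all of L; a smaller field enters only through a predicate on coefficients,
  -- so one instance serves both K and L. Negatives come from the scalar `- 1#`. Decidable equality
  -- is included so that a search can test linear relations.
  record IsVectorSpace (S : Space) : Set where
    open Space S
    field
      isEquivalenceV : IsEquivalence _≈V_
      _≟V_           : Decidable _≈V_
      +V-cong        : ∀ {x x' y y'} → x ≈V x' → y ≈V y' → (x +V y) ≈V (x' +V y')
      ·V-cong        : ∀ {a b x y} → a ≈ b → x ≈V y → (a ·V x) ≈V (b ·V y)
      +V-assoc       : ∀ x y z → ((x +V y) +V z) ≈V (x +V (y +V z))
      +V-comm        : ∀ x y → (x +V y) ≈V (y +V x)
      +V-identityˡ   : ∀ x → (0V +V x) ≈V x
      ·V-distribˡ    : ∀ a x y → (a ·V (x +V y)) ≈V ((a ·V x) +V (a ·V y))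
      ·V-distribʳ    : ∀ x a b → ((a + b) ·V x) ≈V ((a ·V x) +V (b ·V x))
      ·V-assoc       : ∀ a b x → ((a * b) ·V x) ≈V (a ·V (b ·V x))
      ·V-identityˡ   : ∀ x → (1# ·V x) ≈V x
      ·V-zeroˡ       : ∀ x → (0# ·V x) ≈V 0V

  Lsp-isVectorSpace : IsVectorSpace Lsp
  Lsp-isVectorSpace = record
    { isEquivalenceV = isEquivalence ; _≟V_ = _≟_ ; +V-cong = +-cong ; ·V-cong = *-cong
    ; +V-assoc = +-assoc ; +V-comm = +-comm ; +V-identityˡ = +-identityˡ
    ; ·V-distribˡ = distribˡ ; ·V-distribʳ = distribʳ ; ·V-assoc = *-assoc
    ; ·V-identityˡ = *-identityˡ ; ·V-zeroˡ = zeroˡ }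

  Vsp-isVectorSpace : ∀ t → IsVectorSpace (Vsp t)
  Vsp-isVectorSpace t = record
    { isEquivalenceV = record
        { refl = λ _ → refl ; sym = λ p j → sym (p j) ; trans = λ p q j → trans (p j) (q j) }
    ; _≟V_ = λ x y → Fin.all? (λ j → x j ≟ y j)
    ; +V-cong = λ p q j → +-cong (p j) (q j) ; ·V-cong = λ p q j → *-cong p (q j)
    ; +V-assoc = λ x y z j → +-assoc _ _ _ ; +V-comm = λ x y j → +-comm _ _
    ; +V-identityˡ = λ x j → +-identityˡ _
    ; ·V-distribˡ = λ a x y j → distribˡ _ _ _ ; ·V-distribʳ = λ x a b j → distribʳ _ _ _
    ; ·V-assoc = λ a b x j → *-assoc _ _ _
    ; ·V-identityˡ = λ x j → *-identityˡ _ ; ·V-zeroˡ = λ x j → zeroˡ _ }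

  eval-lincomb : ∀ {t d} (c : Fin d → Carrier) (v : Fin d → Fin t → Carrier) j →
                 lincomb (Vsp t) c v j ≈ lincomb Lsp c (λ i → v i j)
  eval-lincomb {d = zero}  c v j = refl
  eval-lincomb {d = suc d} c v j = +-congˡ (eval-lincomb (c ∘ suc) (v ∘ suc) j)

  lincomb-swap : ∀ {d} (c v : Fin d → Carrier) → lincomb Lsp c v ≈ lincomb Lsp v c
  lincomb-swap {zero}  c v = refl
  lincomb-swap {suc d} c v = +-cong (*-comm _ _) (lincomb-swap (c ∘ suc) (v ∘ suc))

  module LinearCombinations {S : Space} (isVS : IsVectorSpace S) where
    open Space S
    open IsVectorSpace isVS public
    open IsEquivalence isEquivalenceV public
      using () renaming (refl to reflV; sym to symV; trans to transV)

    setoidV : Setoid 0ℓ 0ℓ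
    setoidV = record { isEquivalence = isEquivalenceV }

    open SetoidReasoning setoidV

    private
      L : ∀ {d} → (Fin d → Carrier) → (Fin d → V) → V
      L = lincomb S

    +V-identityʳ : ∀ x → (x +V 0V) ≈V x
    +V-identityʳ x = transV (+V-comm _ _) (+V-identityˡ _)

    ·V-zeroʳ : ∀ a → (a ·V 0V) ≈V 0V
    ·V-zeroʳ a = begin
      a ·V 0V          ≈⟨ ·V-cong refl (·V-zeroˡ 0V) ⟨
      a ·V (0# ·V 0V)  ≈⟨ ·V-assoc _ _ _ ⟨
      (a * 0#) ·V 0V   ≈⟨ ·V-cong (zeroʳ a) reflV ⟩
      0# ·V 0V         ≈⟨ ·V-zeroˡ 0V ⟩
      0V               ∎

    +V-interchange : ∀ w x y z → ((w +V x) +V (y +V z)) ≈V ((w +V y) +V (x +V z))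
    +V-interchange w x y z = begin
      (w +V x) +V (y +V z)  ≈⟨ +V-assoc _ _ _ ⟩
      w +V (x +V (y +V z))  ≈⟨ +V-cong reflV (+V-assoc _ _ _) ⟨
      w +V ((x +V y) +V z)  ≈⟨ +V-cong reflV (+V-cong (+V-comm _ _) reflV) ⟩
      w +V ((y +V x) +V z)  ≈⟨ +V-cong reflV (+V-assoc _ _ _) ⟩
      w +V (y +V (x +V z))  ≈⟨ +V-assoc _ _ _ ⟨
      (w +V y) +V (x +V z)  ∎

    ·V-inverseʳ : ∀ a x → ((a ·V x) +V ((- a) ·V x)) ≈V 0V
    ·V-inverseʳ a x = begin
      (a ·V x) +V ((- a) ·V x)  ≈⟨ ·V-distribʳ _ _ _ ⟨
      (a + - a) ·V x            ≈⟨ ·V-cong (-‿inverseʳ a) reflV ⟩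
      0# ·V x                   ≈⟨ ·V-zeroˡ x ⟩
      0V                        ∎

    ·V-inverseˡ : ∀ a x → (((- a) ·V x) +V (a ·V x)) ≈V 0V
    ·V-inverseˡ a x = transV (+V-comm _ _) (·V-inverseʳ a x)

    +V≈0⇒ : ∀ {x y} → (x +V y) ≈V 0V → x ≈V ((- 1#) ·V y)
    +V≈0⇒ {x} {y} p = begin
      x                                    ≈⟨ +V-identityʳ x ⟨
      x +V 0V                              ≈⟨ +V-cong reflV (·V-inverseʳ 1# y) ⟨
      x +V ((1# ·V y) +V ((- 1#) ·V y))    ≈⟨ +V-assoc _ _ _ ⟨
      (x +V (1# ·V y)) +V ((- 1#) ·V y)    ≈⟨ +V-cong (+V-cong reflV (·V-identityˡ y)) reflV ⟩
      (x +V y) +V ((- 1#) ·V y)            ≈⟨ +V-cong p reflV ⟩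
      0V +V ((- 1#) ·V y)                  ≈⟨ +V-identityˡ _ ⟩
      (- 1#) ·V y                          ∎

    lincomb-cong : ∀ {d} {c c' : Fin d → Carrier} {v v' : Fin d → V} →
      (∀ i → c i ≈ c' i) → (∀ i → v i ≈V v' i) → L c v ≈V L c' v'
    lincomb-cong {zero}  p q = reflV
    lincomb-cong {suc d} p q =
      +V-cong (·V-cong (p zero) (q zero)) (lincomb-cong (p ∘ suc) (q ∘ suc))

    lincomb-congˡ : ∀ {d} {c c' : Fin d → Carrier} {v : Fin d → V} →
      (∀ i → c i ≈ c' i) → L c v ≈V L c' v
    lincomb-congˡ p = lincomb-cong p (λ _ → reflV)

    lincomb-congʳ : ∀ {d} {c : Fin d → Carrier} {v v' : Fin d → V} →
      (∀ i → v i ≈V v' i) → L c v ≈V L c v'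
    lincomb-congʳ q = lincomb-cong (λ _ → refl) q

    lincomb-zeroˡ : ∀ {d} (v : Fin d → V) → L (λ _ → 0#) v ≈V 0V
    lincomb-zeroˡ {zero}  v = reflV
    lincomb-zeroˡ {suc d} v =
      transV (+V-cong (·V-zeroˡ _) (lincomb-zeroˡ (v ∘ suc))) (+V-identityˡ 0V)

    lincomb-zeroʳ : ∀ {d} (c : Fin d → Carrier) → L c (λ _ → 0V) ≈V 0V
    lincomb-zeroʳ {zero}  c = reflV
    lincomb-zeroʳ {suc d} c =
      transV (+V-cong (·V-zeroʳ _) (lincomb-zeroʳ (c ∘ suc))) (+V-identityˡ 0V)

    lincomb-+ˡ : ∀ {d} (c c' : Fin d → Carrier) (v : Fin d → V) →
      L (λ i → c i + c' i) v ≈V (L c v +V L c' v)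
    lincomb-+ˡ {zero}  c c' v = symV (+V-identityˡ 0V)
    lincomb-+ˡ {suc d} c c' v = transV
      (+V-cong (·V-distribʳ _ _ _) (lincomb-+ˡ (c ∘ suc) (c' ∘ suc) (v ∘ suc)))
      (+V-interchange _ _ _ _)

    lincomb-+ʳ : ∀ {d} (c : Fin d → Carrier) (v v' : Fin d → V) →
      L c (λ i → v i +V v' i) ≈V (L c v +V L c v')
    lincomb-+ʳ {zero}  c v v' = symV (+V-identityˡ 0V)
    lincomb-+ʳ {suc d} c v v' = transV
      (+V-cong (·V-distribˡ _ _ _) (lincomb-+ʳ (c ∘ suc) (v ∘ suc) (v' ∘ suc)))
      (+V-interchange _ _ _ _)

    lincomb-*ˡ : ∀ {d} a (c : Fin d → Carrier) (v : Fin d → V) →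
      L (λ i → a * c i) v ≈V (a ·V L c v)
    lincomb-*ˡ {zero}  a c v = symV (·V-zeroʳ a)
    lincomb-*ˡ {suc d} a c v = transV
      (+V-cong (·V-assoc _ _ _) (lincomb-*ˡ a (c ∘ suc) (v ∘ suc)))
      (symV (·V-distribˡ _ _ _))

    lincomb-multiples : ∀ {d} (c a : Fin d → Carrier) x →
      L c (λ i → a i ·V x) ≈V (lincomb Lsp c a ·V x)
    lincomb-multiples {zero}  c a x = symV (·V-zeroˡ x)
    lincomb-multiples {suc d} c a x = transV
      (+V-cong (symV (·V-assoc _ _ _)) (lincomb-multiples (c ∘ suc) (a ∘ suc) x))
      (symV (·V-distribʳ _ _ _))

    -- Associativity of the product of the row `c`, the matrix `M` and the column of vectors `g`;
    -- this is how relations are moved between different families.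
    lincomb-assoc : ∀ {d n} (c : Fin d → Carrier) (M : Fin d → Fin n → Carrier) (g : Fin n → V) →
      L c (λ i → L (M i) g) ≈V L (lincomb (Vsp n) c M) g
    lincomb-assoc {zero}  c M g = symV (lincomb-zeroˡ g)
    lincomb-assoc {suc d} c M g = begin
      (c zero ·V L (M zero) g) +V L (c ∘ suc) (λ i → L (M (suc i)) g)
        ≈⟨ +V-cong (symV (lincomb-*ˡ (c zero) (M zero) g)) (lincomb-assoc (c ∘ suc) (M ∘ suc) g) ⟩
      L (λ j → c zero * M zero j) g +V L (lincomb (Vsp _) (c ∘ suc) (M ∘ suc)) g
        ≈⟨ lincomb-+ˡ _ _ g ⟨
      L (lincomb (Vsp _) c M) g ∎

-- Linear algebra over a finite field of scalars: decidability, exchange and dimension.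

module Scalars (F : Field) (K : Over.Subfield F) where
  open Over F
  open VectorSpaces F
  open Field F using (commRing; _≟_; 0≉1; inverse)
  open CommutativeRing commRing hiding (zero)
  open Algebra.Properties.Ring ring using (-‿distribˡ-*)
  open Subfield K

  tuple : ∀ d → Fin (proj₁ finite ℕ.^ d) → Fin d → Carrier
  tuple d i = proj₁ (proj₂ finite) ∘ Fin.finToFun i

  tuple-In : ∀ d (i : Fin (proj₁ finite ℕ.^ d)) j → In (tuple d i j)
  tuple-In d i j = proj₁ (proj₂ (proj₂ finite)) (Fin.finToFun {n = d} i j)

  tuple-surjective : ∀ {d} (c : Fin d → Carrier) → (∀ j → In (c j)) →
    ∃ λ (i : Fin (proj₁ finite ℕ.^ d)) → ∀ j → c j ≈ tuple d i j
  tuple-surjective c c∈ = Fin.funToFin (proj₁ ∘ index) , λ j → trans (proj₂ (index j))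
      (reflexive (≡.cong (proj₁ (proj₂ finite)) (≡.sym (Fin.finToFun-funToFin (proj₁ ∘ index) j))))
    where
    index = λ j → proj₂ (proj₂ (proj₂ finite)) (c j) (c∈ j)

  -- The coefficient tuples are finitely many, listed by `tuple`. The list meets each tuple only up
  -- to `≈`, hence the condition that `Q` respects it.
  search : ∀ {d} (Q : (Fin d → Carrier) → Set) →
    (∀ {c c'} → (∀ i → c i ≈ c' i) → Q c → Q c') → (∀ c → Dec (Q c)) →
    Dec (∃ λ c → (∀ i → In (c i)) × Q c)
  search {d} Q Q-resp Q? =
    map′ (λ (i , p) → tuple d i , tuple-In d i , p)
         (λ (c , c∈ , p) → let i , c≈ = tuple-surjective c c∈ in i , Q-resp c≈ p)
         (Fin.any? (λ i → Q? (tuple d i)))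

  ∷-In : ∀ {d a} {c : Fin d → Carrier} → In a → (∀ i → In (c i)) → ∀ i → In ((a ∷ c) i)
  ∷-In a∈ c∈ zero    = a∈
  ∷-In a∈ c∈ (suc i) = c∈ i

  lincomb-In : ∀ {d} {c a : Fin d → Carrier} → (∀ i → In (c i)) → (∀ i → In (a i)) →
    In (lincomb Lsp c a)
  lincomb-In {zero}  c∈ a∈ = has0
  lincomb-In {suc d} c∈ a∈ =
    +-closed (*-closed (c∈ zero) (a∈ zero)) (lincomb-In (c∈ ∘ suc) (a∈ ∘ suc))

  lincombV-In : ∀ {d n} {c : Fin d → Carrier} {M : Fin d → Fin n → Carrier} →
    (∀ i → In (c i)) → (∀ i j → In (M i j)) → ∀ j → In (lincomb (Vsp n) c M j)
  lincombV-In {c = c} {M} c∈ M∈ j = resp (sym (eval-lincomb c M j)) (lincomb-In c∈ (λ i → M∈ i j))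

  module Dimension {S : Space} (isVS : IsVectorSpace S) where
    open Space S
    open LinearCombinations isVS
    open SetoidReasoning setoidV

    Dependent : ∀ {d} → (Fin d → V) → Set
    Dependent v = ∃ λ c → (∀ i → In (c i)) × (lincomb S c v ≈V 0V) × ∃ λ i → ¬ (c i ≈ 0#)

    dependent? : ∀ {d} (v : Fin d → V) → Dec (Dependent v)
    dependent? v = search _
      (λ p (e , i , ne) → transV (lincomb-congˡ (λ j → sym (p j))) e , i , λ z → ne (trans (p i) z))
      (λ c → (lincomb S c v ≟V 0V) ×-dec Fin.any? (λ i → ¬? (c i ≟ 0#)))

    ¬dependent⇒indep : ∀ {d} {v : Fin d → V} → ¬ Dependent v → LinIndep S In v
    ¬dependent⇒indep ¬dep c c∈ e i with c i ≟ 0#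
    ... | yes z = z
    ... | no nz = ⊥-elim (¬dep (c , c∈ , e , i , nz))

    indep⇒¬dependent : ∀ {d} {v : Fin d → V} → LinIndep S In v → ¬ Dependent v
    indep⇒¬dependent ind (c , c∈ , e , i , nz) = nz (ind c c∈ e i)

    ¬indep⇒dependent : ∀ {d} {v : Fin d → V} → ¬ LinIndep S In v → Dependent v
    ¬indep⇒dependent {v = v} ¬ind with dependent? v
    ... | yes dep = dep
    ... | no ¬dep = ⊥-elim (¬ind (¬dependent⇒indep ¬dep))

    span? : ∀ {d} (v : Fin d → V) x → Dec (Span S In v x)
    span? v x = search _ (λ p e → transV e (lincomb-congˡ p)) (λ c → x ≟V lincomb S c v)

    span-isSubspace : ∀ {d} (v : Fin d → V) → IsSubspace S In (Span S In v)
    span-isSubspace v =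
      ((λ _ → 0#) , (λ _ → has0) , symV (lincomb-zeroˡ v)) ,
      (λ (c , c∈ , p) (c' , c'∈ , p') →
        _ , (λ i → +-closed (c∈ i) (c'∈ i)) , transV (+V-cong p p') (symV (lincomb-+ˡ c c' v))) ,
      (λ {a} a∈ (c , c∈ , p) →
        _ , (λ i → *-closed a∈ (c∈ i)) , transV (·V-cong refl p) (symV (lincomb-*ˡ a c v))) ,
      (λ x≈y (c , c∈ , p) → c , c∈ , transV (symV x≈y) p)

    lincomb∈ : ∀ {W} → IsSubspace S In W → ∀ {d} {c : Fin d → Carrier} {v : Fin d → V} →
      (∀ i → In (c i)) → (∀ i → W (v i)) → W (lincomb S c v)
    lincomb∈ (0∈ , _) {zero} c∈ v∈ = 0∈
    lincomb∈ W@(_ , +∈ , ·∈ , _) {suc d} c∈ v∈ =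
      +∈ (·∈ (c∈ zero) (v∈ zero)) (lincomb∈ W (c∈ ∘ suc) (v∈ ∘ suc))

    span⊆ : ∀ {W} → IsSubspace S In W → ∀ {d} {v : Fin d → V} →
      (∀ i → W (v i)) → Span S In v ⊆ W
    span⊆ W@(_ , _ , _ , resp∈) v∈ (c , c∈ , p) = resp∈ (symV p) (lincomb∈ W c∈ v∈)

    span-weaken : ∀ {d} {v : Fin (suc d) → V} → Span S In (v ∘ suc) ⊆ Span S In v
    span-weaken {v = v} (c , c∈ , p) = 0# ∷ c , ∷-In has0 c∈ ,
      transV p (symV (transV (+V-cong (·V-zeroˡ _) reflV) (+V-identityˡ _)))

    generator∈span : ∀ {d} (v : Fin d → V) i → Span S In v (v i)
    generator∈span v zero = 1# ∷ (λ _ → 0#) , ∷-In has1 (λ _ → has0) ,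
      symV (transV (+V-cong (·V-identityˡ _) (lincomb-zeroˡ (v ∘ suc))) (+V-identityʳ _))
    generator∈span v (suc i) = span-weaken {v = v} (generator∈span (v ∘ suc) i)

    relation⇒∈span : ∀ {d} {v : Fin (suc d) → V} {c} → (∀ i → In (c i)) →
      lincomb S c v ≈V 0V → ¬ (c zero ≈ 0#) → Span S In (v ∘ suc) (v zero)
    relation⇒∈span {v = v} {c} c∈ e nz with inverse (c zero) nz
    ... | b , cb≈1 = (λ i → (b * - 1#) * c (suc i)) ,
        (λ i → *-closed (*-closed (inv-closed (c∈ zero) cb≈1) (neg-closed has1)) (c∈ (suc i))) ,
        (begin
          v zero                                ≈⟨ ·V-identityˡ _ ⟨
          1# ·V v zero                          ≈⟨ ·V-cong (trans (sym cb≈1) (*-comm _ _)) reflV ⟩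
          (b * c zero) ·V v zero                ≈⟨ ·V-assoc _ _ _ ⟩
          b ·V (c zero ·V v zero)               ≈⟨ ·V-cong refl (+V≈0⇒ e) ⟩
          b ·V ((- 1#) ·V lincomb S (c ∘ suc) (v ∘ suc))  ≈⟨ ·V-assoc _ _ _ ⟨
          (b * - 1#) ·V lincomb S (c ∘ suc) (v ∘ suc)     ≈⟨ lincomb-*ˡ _ (c ∘ suc) _ ⟨
          lincomb S (λ i → (b * - 1#) * c (suc i)) (v ∘ suc) ∎)

    -- In a relation the coefficient of `x` must vanish, since otherwise the relation could be
    -- solved for `x`; what is left is a relation of `v`.
    indep-∷ : ∀ {d} {v : Fin d → V} {x} → LinIndep S In v → ¬ Span S In v x →
      LinIndep S In (x ∷ v)
    indep-∷ {v = v} {x} ind x∉ c c∈ e = λ where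
        zero    → c₀≈0
        (suc i) → ind (c ∘ suc) (c∈ ∘ suc)
          (transV (symV (transV (+V-cong (transV (·V-cong c₀≈0 reflV) (·V-zeroˡ x)) reflV)
                                (+V-identityˡ _))) e) i
      where
      c₀≈0 : c zero ≈ 0#
      c₀≈0 with c zero ≟ 0#
      ... | yes z = z
      ... | no nz = ⊥-elim (x∉ (relation⇒∈span {v = x ∷ v} c∈ e nz))

    indep-tail : ∀ {d} {v : Fin (suc d) → V} → LinIndep S In v → LinIndep S In (v ∘ suc)
    indep-tail ind c c∈ e i = ind (0# ∷ c) (∷-In has0 c∈)
      (transV (+V-cong (·V-zeroˡ _) reflV) (transV (+V-identityˡ _) e)) (suc i)

    dependent-∷ : ∀ {d} {v : Fin d → V} x → Dependent v → Dependent (x ∷ v)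
    dependent-∷ x (c , c∈ , e , i , nz) =
      0# ∷ c , ∷-In has0 c∈ , transV (+V-cong (·V-zeroˡ _) reflV) (transV (+V-identityˡ _) e) ,
      suc i , nz

    hasIndep-≤ : ∀ {W d e} → d ℕ.≤ e → HasIndep S In W e → HasIndep S In W d
    hasIndep-≤ {W} d≤e = go (ℕ.≤⇒≤′ d≤e)
      where
      go : ∀ {d e} → d ℕ.≤′ e → HasIndep S In W e → HasIndep S In W d
      go ℕ.≤′-refl         h              = h
      go (ℕ.≤′-step d≤e) (v , v∈ , ind) = go d≤e (v ∘ suc , v∈ ∘ suc , indep-tail {v = v} ind)

    indep≤ : ∀ {W d e} → HasIndep S In W d → DimLe S In W e → d ℕ.≤ e
    indep≤ {W} {d} {e} h le with d ℕ.≤? e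
    ... | yes p = p
    ... | no ¬p = ⊥-elim (le (hasIndep-≤ {W} (ℕ.≰⇒> ¬p) h))

    hasIndep-⊆ : ∀ {W W' d} → W ⊆ W' → HasIndep S In W d → HasIndep S In W' d
    hasIndep-⊆ W⊆W' (v , v∈ , ind) = v , (λ i → W⊆W' (v∈ i)) , ind

    dim-⊆ : ∀ {W W' d d'} → W ⊆ W' → HasDim S In W d → HasDim S In W' d' → d ℕ.≤ d'
    dim-⊆ {W} {W'} W⊆W' (h , _) (_ , le) = indep≤ {W'} (hasIndep-⊆ {W} {W'} W⊆W' h) le

    dim-unique : ∀ {W W' d d'} → W ⊆ W' → W' ⊆ W → HasDim S In W d → HasDim S In W' d' → d ≡ d'
    dim-unique {W} {W'} p q h h' = ℕ.≤-antisym (dim-⊆ {W} {W'} p h h') (dim-⊆ {W'} {W} q h' h)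

    -- A vector of `W` outside the span would give an independent family that is too long; `span?`
    -- turns this contradiction into membership.
    maximal⇒spans : ∀ {W d} {v : Fin d → V} → (∀ i → W (v i)) → LinIndep S In v →
      DimLe S In W d → W ⊆ Span S In v
    maximal⇒spans {W} {v = v} v∈ ind le {x} x∈ with span? v x
    ... | yes p = p
    ... | no ¬p = ⊥-elim (le (x ∷ v , (λ { zero → x∈ ; (suc i) → v∈ i }) , indep-∷ ind ¬p))

    -- One step of Gaussian elimination: from w i = c i · x + s i the vector x is eliminated
    -- at the cost of one member of the family.
    eliminate : ∀ {W} → IsSubspace S In W → ∀ {e} (w s : Fin (suc e) → V) (c : Fin (suc e) → Carrier)
      x → (∀ i → In (c i)) → (∀ i → W (s i)) → (∀ i → w i ≈V ((c i ·V x) +V s i)) →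
      ∃ λ (w' : Fin e → V) → (∀ i → W (w' i)) ×
        (∀ a → (∀ i → In (a i)) → ∃ λ b → (∀ i → In (b i)) ×
          (lincomb S b w ≈V lincomb S a w') × (∀ i → ¬ (a i ≈ 0#) → ∃ λ j → ¬ (b j ≈ 0#)))
    eliminate W-sub@(_ , +∈ , ·∈ , resp∈) {e} w s c x c∈ s∈ w≈ with c zero ≟ 0#
    eliminate {W} W-sub@(_ , +∈ , ·∈ , resp∈) {e} w s c x c∈ s∈ w≈ | no nz
      with inverse (c zero) nz
    ... | b , c₀b≈1 = w' , w'∈ , λ a a∈ →
          lincomb Lsp a r ∷ a , ∷-In (lincomb-In a∈ r∈) a∈ ,
          (begin
            (lincomb Lsp a r ·V w zero) +V lincomb S a (w ∘ suc)
              ≈⟨ +V-cong (lincomb-multiples a r (w zero)) reflV ⟨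
            lincomb S a (λ i → r i ·V w zero) +V lincomb S a (w ∘ suc)
              ≈⟨ lincomb-+ʳ a _ _ ⟨
            lincomb S a w' ∎) ,
          λ i ne → suc i , ne
      where
      r : Fin e → Carrier
      r i = - (c (suc i) * b)

      r∈ : ∀ i → In (r i)
      r∈ i = neg-closed (*-closed (c∈ (suc i)) (inv-closed (c∈ zero) c₀b≈1))

      rc₀ : ∀ i → r i * c zero ≈ - c (suc i)
      rc₀ i = trans (sym (-‿distribˡ-* _ _)) (-‿cong
        (trans (*-assoc _ _ _) (trans (*-congˡ (trans (*-comm _ _) c₀b≈1)) (*-identityʳ _))))

      w' : Fin e → V
      w' i = (r i ·V w zero) +V w (suc i)

      w'∈ : ∀ i → W (w' i)
      w'∈ i = resp∈ (symV (begin
        (r i ·V w zero) +V w (suc i)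
          ≈⟨ +V-cong (·V-cong refl (w≈ zero)) (w≈ (suc i)) ⟩
        (r i ·V ((c zero ·V x) +V s zero)) +V ((c (suc i) ·V x) +V s (suc i))
          ≈⟨ +V-cong (·V-distribˡ _ _ _) reflV ⟩
        ((r i ·V (c zero ·V x)) +V (r i ·V s zero)) +V ((c (suc i) ·V x) +V s (suc i))
          ≈⟨ +V-interchange _ _ _ _ ⟩
        ((r i ·V (c zero ·V x)) +V (c (suc i) ·V x)) +V ((r i ·V s zero) +V s (suc i))
          ≈⟨ +V-cong (+V-cong (symV (·V-assoc _ _ _)) reflV) reflV ⟩
        (((r i * c zero) ·V x) +V (c (suc i) ·V x)) +V ((r i ·V s zero) +V s (suc i))
          ≈⟨ +V-cong (+V-cong (·V-cong (rc₀ i) reflV) reflV) reflV ⟩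
        (((- c (suc i)) ·V x) +V (c (suc i) ·V x)) +V ((r i ·V s zero) +V s (suc i))
          ≈⟨ +V-cong (·V-inverseˡ _ x) reflV ⟩
        0V +V ((r i ·V s zero) +V s (suc i))
          ≈⟨ +V-identityˡ _ ⟩
        (r i ·V s zero) +V s (suc i) ∎))
        (+∈ (·∈ (r∈ i) (s∈ zero)) (s∈ (suc i)))
    eliminate W-sub {zero} w s c x c∈ s∈ w≈ | yes z =
      (λ ()) , (λ ()) , λ a a∈ → (λ _ → 0#) , (λ _ → has0) , lincomb-zeroˡ w , λ ()
    eliminate {W} W-sub@(_ , +∈ , ·∈ , resp∈) {suc e} w s c x c∈ s∈ w≈ | yes z
      with eliminate {W} W-sub (w ∘ suc) (s ∘ suc) (c ∘ suc) x (c∈ ∘ suc) (s∈ ∘ suc) (w≈ ∘ suc)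
    ... | w' , w'∈ , lift = w zero ∷ w' ,
          (λ { zero    → resp∈ (symV (transV (w≈ zero) (transV
                           (+V-cong (transV (·V-cong z reflV) (·V-zeroˡ x)) reflV) (+V-identityˡ _))))
                           (s∈ zero)
             ; (suc i) → w'∈ i }) ,
          λ a a∈ → let b , b∈ , p , nonzero = lift (a ∘ suc) (a∈ ∘ suc) in
            a zero ∷ b , ∷-In (a∈ zero) b∈ , +V-cong reflV p ,
            λ { zero ne → zero , ne
              ; (suc i) ne → let j , ne' = nonzero i ne in suc j , ne' }

    -- Induction on `d`: eliminating `v zero` leaves one vector fewer, all in the span of the
    -- remaining generators, and a nontrivial relation among these lifts back. For `d` zero the
    -- single vector of `w` is zero, so the coefficient 1 is a relation.
    steinitz : ∀ {d} (v : Fin d → V) (w : Fin (suc d) → V) → (∀ i → Span S In v (w i)) → Dependent w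
    steinitz {zero}  v w w∈ = (λ _ → 1#) , (λ _ → has1) ,
      transV (+V-identityʳ _) (transV (·V-identityˡ _) (proj₂ (proj₂ (w∈ zero)))) ,
      zero , λ 1≈0 → 0≉1 (sym 1≈0)
    steinitz {suc d} v w w∈
      with eliminate (span-isSubspace (v ∘ suc)) w (λ i → lincomb S (proj₁ (w∈ i) ∘ suc) (v ∘ suc))
             (λ i → proj₁ (w∈ i) zero) (v zero) (λ i → proj₁ (proj₂ (w∈ i)) zero)
             (λ i → _ , (λ j → proj₁ (proj₂ (w∈ i)) (suc j)) , reflV) (λ i → proj₂ (proj₂ (w∈ i)))
    ... | w' , w'∈ , lift with steinitz (v ∘ suc) w' w'∈
    ... | a , a∈ , e , i , ne with lift a a∈
    ... | b , b∈ , p , nonzero = b , b∈ , transV p e , nonzero i ne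

    spanned⇒dim≤ : ∀ {W d} {v : Fin d → V} → W ⊆ Span S In v → DimLe S In W d
    spanned⇒dim≤ {v = v} W⊆ (w , w∈ , ind) =
      indep⇒¬dependent {v = w} ind (steinitz v w (λ i → W⊆ (w∈ i)))

    basis⇒dim : ∀ {W d} {v : Fin d → V} → (∀ i → W (v i)) → LinIndep S In v → W ⊆ Span S In v →
      HasDim S In W d
    basis⇒dim {W} v∈ ind W⊆ = (_ , v∈ , ind) , spanned⇒dim≤ {W} W⊆

    -- By `steinitz`, `a + 1` independent vectors of `W` cannot all lie in the span of the `a`
    -- vectors `v`; a finite check finds one that does not.
    extend : ∀ {W a N} {v : Fin a → V} → HasIndep S In W N → a ℕ.< N → LinIndep S In v →
      ∃ λ x → W x × LinIndep S In (x ∷ v)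
    extend {W} {N = N} {v = v} h a<N ind with hasIndep-≤ {W} a<N h
    ... | w , w∈ , w-ind with Fin.all? (λ i → span? v (w i))
    ... | yes all = ⊥-elim (indep⇒¬dependent {v = w} w-ind (steinitz v w all))
    ... | no ¬all with Fin.¬∀⟶∃¬ _ _ (λ i → span? v (w i)) ¬all
    ... | i , wᵢ∉ = w i , w∈ i , indep-∷ ind wᵢ∉

    -- `P` is an invariant kept while vectors are added. It is used over L to retain a given
    -- subspace inside the span, and over K to retain a dependence over L.
    extend-to : (P : ∀ {a} → (Fin a → V) → Set) {W : Pred V 0ℓ} →
      (∀ {a} {v : Fin a → V} x → W x → P v → P (x ∷ v)) →
      ∀ {a t N} → a ℕ.≤ t → t ℕ.≤ N → HasIndep S In W N →
      {v : Fin a → V} → LinIndep S In v → P v → ∃ λ (v' : Fin t → V) → LinIndep S In v' × P v'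
    extend-to P {W} P-∷ {N = N} a≤t t≤N h = go (ℕ.≤⇒≤′ a≤t) t≤N
      where
      go : ∀ {a t} → a ℕ.≤′ t → t ℕ.≤ N → {v : Fin a → V} → LinIndep S In v → P v →
        ∃ λ (v' : Fin t → V) → LinIndep S In v' × P v'
      go ℕ.≤′-refl t≤N ind p = _ , ind , p
      go (ℕ.≤′-step a≤t) t<N ind p =
        let v' , ind' , p' = go a≤t (ℕ.<⇒≤ t<N) ind p
            x , x∈ , ind″  = extend {W} h t<N ind'
        in x ∷ v' , ind″ , P-∷ x x∈ p'

    indep⇒head∉span : ∀ {d} {v : Fin (suc d) → V} → LinIndep S In v → ¬ Span S In (v ∘ suc) (v zero)
    indep⇒head∉span {v = v} ind (c , c∈ , e) = 0≉1 (sym (ind (1# ∷ (λ i → - 1# * c i))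
      (∷-In has1 (λ i → *-closed (neg-closed has1) (c∈ i)))
      (transV (+V-cong reflV (transV (lincomb-*ˡ (- 1#) c _) (·V-cong refl (symV e)))) (·V-inverseʳ 1# _))
      zero))

    -- A relation among the combinations is a relation of `g` with coefficient row `c M`, so this
    -- row vanishes, and then so does `c`.
    combinations-indep : ∀ {a n} {g : Fin n → V} {M : Fin a → Fin n → Carrier} →
      LinIndep S In g → (∀ i j → In (M i j)) → LinIndep (Vsp n) In M →
      LinIndep S In (λ i → lincomb S (M i) g)
    combinations-indep {g = g} {M} g-ind M∈ M-ind c c∈ e =
      M-ind c c∈ (g-ind _ (lincombV-In c∈ M∈) (transV (symV (lincomb-assoc c M g)) e))

-- Independent families in coordinate spaces, rank factorisation and rank-nullity.

module Rank (F : Field) (K : Over.Subfield F) where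
  open Over F
  open VectorSpaces F
  open Scalars F K
  open Field F using (commRing; _≟_; 0≉1)
  open CommutativeRing commRing hiding (zero)
  open Algebra.Properties.Ring ring using (-1*x≈-x)
  open Subfield K

  private
    module LL = LinearCombinations Lsp-isVectorSpace
    module DL = Dimension Lsp-isVectorSpace
    module DV {n} = Dimension (Vsp-isVectorSpace n)

  eval-tail : ∀ {n d} (a : Fin d → Carrier) (c : Fin d → Carrier) (M : Fin d → Fin n → Carrier) j →
    lincomb (Vsp (suc n)) c (λ i → a i ∷ M i) (suc j) ≈ lincomb (Vsp n) c M j
  eval-tail a c M j = trans (eval-lincomb c (λ i → a i ∷ M i) (suc j)) (sym (eval-lincomb c M j))

  eval-head-0 : ∀ {n d} (c : Fin d → Carrier) (M : Fin d → Fin n → Carrier) →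
    lincomb (Vsp (suc n)) c (λ i → 0# ∷ M i) zero ≈ 0#
  eval-head-0 c M = trans (eval-lincomb c (λ i → 0# ∷ M i) zero) (LL.lincomb-zeroʳ c)

  indep-prefix : ∀ {n d} (a : Fin d → Carrier) (M : Fin d → Fin n → Carrier) →
    LinIndep (Vsp n) In M → LinIndep (Vsp (suc n)) In (λ i → a i ∷ M i)
  indep-prefix a M ind c c∈ e = ind c c∈ (λ j → trans (sym (eval-tail a c M j)) (e (suc j)))

  -- The leading 1 keeps the first vector out of the span of the others, whose first coordinates are
  -- all 0.
  indep-echelon : ∀ {n d} (x : Fin n → Carrier) (M : Fin d → Fin n → Carrier) →
    LinIndep (Vsp n) In M → LinIndep (Vsp (suc n)) In ((1# ∷ x) ∷ (λ i → 0# ∷ M i))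
  indep-echelon x M ind = DV.indep-∷ {v = λ i → 0# ∷ M i} (indep-prefix (λ _ → 0#) M ind)
    (λ (c , _ , e) → 0≉1 (sym (trans (e zero) (eval-head-0 c M))))

  std : ∀ {n} → Fin n → Fin n → Carrier
  std {suc n} = (1# ∷ (λ _ → 0#)) ∷ (λ i → 0# ∷ std i)

  std-indep : ∀ {n} → LinIndep (Vsp n) In (std {n})
  std-indep {zero}  c c∈ e ()
  std-indep {suc n} = indep-echelon (λ _ → 0#) std std-indep

  std-spans : ∀ {n} (x : Fin n → Carrier) → Span (Vsp n) AllL std x
  std-spans x = x , _ , go x
    where
    go : ∀ {n} (x : Fin n → Carrier) j → x j ≈ lincomb (Vsp n) x std j
    go x zero    = sym (trans (+-cong (*-identityʳ _) (eval-head-0 (x ∘ suc) std)) (+-identityʳ _))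
    go x (suc j) = sym (trans (+-cong (zeroʳ _) (eval-tail (λ _ → 0#) (x ∘ suc) std j))
                         (trans (+-identityˡ _) (sym (go (x ∘ suc) j))))

  -- The last condition keeps track of the first coordinates, so that vectors b i ∷ 0 can be
  -- added one at a time.
  hasIndep-product-suc : ∀ {W : Pred Carrier 0ℓ} → W 0# → ∀ {a n N} (b : Fin a → Carrier) →
    (∀ i → W (b i)) → LinIndep Lsp In b → HasIndep (Vsp n) In (λ y → ∀ j → W (y j)) N →
    ∃ λ (v : Fin (a ℕ.+ N) → Fin (suc n) → Carrier) → (∀ i j → W (v i j)) ×
      LinIndep (Vsp (suc n)) In v × (∀ i → Span Lsp In b (v i zero))
  hasIndep-product-suc 0∈ {zero} b b∈ b-ind (v , v∈ , ind) =
    (λ i → 0# ∷ v i) , (λ { i zero → 0∈ ; i (suc j) → v∈ i j }) , indep-prefix (λ _ → 0#) v ind ,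
    (λ i → (λ ()) , (λ ()) , refl)
  hasIndep-product-suc {W} 0∈ {suc a} {n} b b∈ b-ind h
    with hasIndep-product-suc {W} 0∈ (b ∘ suc) (b∈ ∘ suc) (DL.indep-tail {v = b} b-ind) h
  ... | v , v∈ , ind , heads =
    (b zero ∷ (λ _ → 0#)) ∷ v ,
    (λ { zero zero → b∈ zero ; zero (suc j) → 0∈ ; (suc i) j → v∈ i j }) ,
    DV.indep-∷ ind (λ b₀∈ → DL.indep⇒head∉span {v = b} b-ind
      (DV.span⊆ {W = λ x → Span Lsp In (b ∘ suc) (x zero)}
        (proj₁ sub , proj₁ (proj₂ sub) , proj₁ (proj₂ (proj₂ sub)) ,
          λ x≈y → proj₂ (proj₂ (proj₂ sub)) (x≈y zero)) heads b₀∈)) ,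
    (λ { zero → DL.generator∈span b zero ; (suc i) → DL.span-weaken {v = b} (heads i) })
    where
    sub = DL.span-isSubspace (b ∘ suc)

  hasIndep-product : ∀ {W : Pred Carrier 0ℓ} → W 0# → ∀ n {d} → HasIndep Lsp In W d →
    HasIndep (Vsp n) In (λ y → ∀ j → W (y j)) (n ℕ.* d)
  hasIndep-product 0∈ zero h = (λ ()) , (λ ()) , λ _ _ _ ()
  hasIndep-product {W} 0∈ (suc n) h@(b , b∈ , b-ind)
    with hasIndep-product-suc {W} 0∈ b b∈ b-ind (hasIndep-product {W} 0∈ n h)
  ... | v , v∈ , ind , _ = v , v∈ , ind

  module RankNullity {S : Space} (isVS : IsVectorSpace S) where
    open Space S
    open LinearCombinations isVS
    open Dimension isVS

    -- Both sides of the K-linear map Kⁿ → V, c ↦ lincomb c y: a basis of its image, through which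
    -- it factors by linearly independent coordinate rows, and a basis of its kernel.
    record RankData {n} (y : Fin n → V) : Set where
      field
        rank nullity    : ℕ
        rank+nullity    : rank ℕ.+ nullity ≡ n
        basis           : Fin rank → V
        basis-indep     : LinIndep S In basis
        basis∈span      : ∀ i → Span S In y (basis i)
        coord           : Fin rank → Fin n → Carrier
        coord-In        : ∀ i j → In (coord i j)
        coord-indep     : LinIndep (Vsp n) In coord
        factorisation   : ∀ j → y j ≈V lincomb S (λ i → coord i j) basis
        kernel          : Fin nullity → Fin n → Carrier
        kernel-In       : ∀ i j → In (kernel i j)
        kernel-indep    : LinIndep (Vsp n) In kernel
        kernel-relation : ∀ i → lincomb S (kernel i) y ≈V 0V
        kernel-complete : ∀ c → (∀ j → In (c j)) → lincomb S c y ≈V 0V → Span (Vsp n) In kernel c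

      generators⊆span-basis : ∀ j → Span S In basis (y j)
      generators⊆span-basis j = (λ i → coord i j) , (λ i → coord-In i j) , factorisation j

      span-dim : HasDim S In (Span S In y) rank
      span-dim = basis⇒dim {Span S In y} basis∈span basis-indep
        (span⊆ (span-isSubspace basis) generators⊆span-basis)

      -- A nontrivial relation is a nonzero kernel vector, so the nullity is positive.
      dependent⇒rank< : Dependent y → rank ℕ.< n
      dependent⇒rank< (c , c∈ , e , i , cᵢ≉0) = go kernel (kernel-complete c c∈ e) rank+nullity
        where
        go : ∀ {d} (κ : Fin d → Fin n → Carrier) → Span (Vsp n) In κ c → rank ℕ.+ d ≡ n → rank ℕ.< n
        go {zero}  κ (_ , _ , p) eq = ⊥-elim (cᵢ≉0 (p i))
        go {suc d} κ _           eq =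
          ≡.subst (rank ℕ.<_) eq (ℕ.m<m+n rank (ℕ.s≤s ℕ.z≤n))

      -- Independence of `g` identifies K^n with the span of `g`. The two hypotheses about `Z` say
      -- that the kernel corresponds exactly to the part of that span inside `Z`, so the two have
      -- the same dimension.
      kernel-transport-dim : ∀ {S₂} (isVS₂ : IsVectorSpace S₂) (g : Fin n → Space.V S₂) →
        LinIndep S₂ In g → (Z : Pred (Space.V S₂) 0ℓ) →
        (∀ c → (∀ j → In (c j)) → lincomb S c y ≈V 0V → Z (lincomb S₂ c g)) →
        (∀ c → (∀ j → In (c j)) → ∀ x → Z x → Space._≈V_ S₂ x (lincomb S₂ c g) → lincomb S c y ≈V 0V) →
        HasDim S₂ In (Span S₂ In g ∩ Z) nullity
      kernel-transport-dim {S₂} isVS₂ g g-ind Z into out =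
        D₂.basis⇒dim {Span S₂ In g ∩ Z}
          (λ i → (kernel i , kernel-In i , C₂.reflV) , into _ (kernel-In i) (kernel-relation i))
          (D₂.combinations-indep g-ind kernel-In kernel-indep)
          (λ {x} ((c , c∈ , p) , z) →
            let d , d∈ , e = kernel-complete c c∈ (out c c∈ x z p) in
            d , d∈ , C₂.transV p (C₂.transV (C₂.lincomb-congˡ e) (C₂.symV (C₂.lincomb-assoc d kernel g))))
        where
        module C₂ = LinearCombinations isVS₂
        module D₂ = Dimension isVS₂

    private
      -1·+1· : ∀ a b c → a * (- 1# * b) + (a * b + c) ≈ c
      -1·+1· a b c = trans (sym (+-assoc _ _ _)) (trans (+-congʳ
        (trans (sym (distribˡ a _ _)) (trans (*-congˡ (trans (+-congʳ (-1*x≈-x b)) (-‿inverseˡ b)))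
          (zeroʳ a)))) (+-identityˡ c))

    -- Induction on the number of generators. If `y zero` is a combination `μ` of the others, the
    -- basis stays and the kernel gains the vector (1, -μ); otherwise the basis gains `y zero` and
    -- the old kernel vectors are padded with 0.
    rankData : ∀ {n} (y : Fin n → V) → RankData y
    rankData {zero} y = record
      { rank = 0 ; nullity = 0 ; rank+nullity = ≡.refl
      ; basis = λ () ; basis-indep = λ _ _ _ () ; basis∈span = λ ()
      ; coord = λ () ; coord-In = λ () ; coord-indep = λ _ _ _ () ; factorisation = λ ()
      ; kernel = λ () ; kernel-In = λ () ; kernel-indep = λ _ _ _ () ; kernel-relation = λ ()
      ; kernel-complete = λ c c∈ e → (λ ()) , (λ ()) , λ () }
    rankData {suc n} y with rankData (y ∘ suc) | span? (y ∘ suc) (y zero)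
    ... | r | yes y₀∈@(μ , μ∈ , y₀≈) = record
      { rank = rank ; nullity = suc nullity
      ; rank+nullity = ≡.trans (ℕ.+-suc rank nullity) (≡.cong suc rank+nullity)
      ; basis = basis ; basis-indep = basis-indep
      ; basis∈span = λ i → span-weaken {v = y} (basis∈span i)
      ; coord = λ i → ν i ∷ coord i ; coord-In = λ i → ∷-In (ν∈ i) (coord-In i)
      ; coord-indep = indep-prefix ν coord coord-indep
      ; factorisation = λ { zero → y₀≈ν ; (suc j) → factorisation j }
      ; kernel = κ
      ; kernel-In = λ { zero    → ∷-In has1 (λ j → *-closed (neg-closed has1) (μ∈ j))
                      ; (suc i) → ∷-In has0 (kernel-In i) }
      ; kernel-indep = indep-echelon _ kernel kernel-indep
      ; kernel-relation = λ
          { zero    → transV (+V-cong reflV (transV (lincomb-*ˡ (- 1#) μ _) (·V-cong refl (symV y₀≈))))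
                        (·V-inverseʳ 1# _)
          ; (suc i) → transV (+V-cong (·V-zeroˡ _) (kernel-relation i)) (+V-identityˡ _) }
      ; kernel-complete = complete }
      where
      open RankData r
      y₀∈basis : Span S In basis (y zero)
      y₀∈basis = span⊆ (span-isSubspace basis) generators⊆span-basis y₀∈
      ν = proj₁ y₀∈basis
      ν∈ = proj₁ (proj₂ y₀∈basis)
      y₀≈ν = proj₂ (proj₂ y₀∈basis)
      κ : Fin (suc nullity) → Fin (suc n) → Carrier
      κ = (1# ∷ (λ j → - 1# * μ j)) ∷ (λ i → 0# ∷ kernel i)
      complete : ∀ c → (∀ j → In (c j)) → lincomb S c y ≈V 0V → Span (Vsp (suc n)) In κ c
      complete c c∈ e =
        -- Subtracting `c zero` times (1, -μ) from `c` clears its first coordinate and leaves a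
        -- relation among the other generators.
        let d , d∈ , p = kernel-complete (λ j → c zero * μ j + c (suc j))
              (λ j → +-closed (*-closed (c∈ zero) (μ∈ j)) (c∈ (suc j)))
              (transV (lincomb-+ˡ (λ j → c zero * μ j) (c ∘ suc) _)
                (transV (+V-cong (transV (lincomb-*ˡ (c zero) μ _) (·V-cong refl (symV y₀≈))) reflV) e))
        in c zero ∷ d , ∷-In (c∈ zero) d∈ , λ
          { zero    → sym (trans (+-cong (*-identityʳ _) (eval-head-0 d kernel)) (+-identityʳ _))
          ; (suc j) → sym (trans (+-congˡ (trans (eval-tail (λ _ → 0#) d kernel j) (sym (p j))))
                        (-1·+1· (c zero) (μ j) (c (suc j)))) }
    ... | r | no y₀∉ = record
      { rank = suc rank ; nullity = nullity ; rank+nullity = ≡.cong suc rank+nullity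
      ; basis = y zero ∷ basis
      ; basis-indep = indep-∷ basis-indep (λ s → y₀∉ (span⊆ (span-isSubspace (y ∘ suc)) basis∈span s))
      ; basis∈span = λ { zero    → generator∈span y zero
                       ; (suc i) → span-weaken {v = y} (basis∈span i) }
      ; coord = (1# ∷ (λ _ → 0#)) ∷ (λ i → 0# ∷ coord i)
      ; coord-In = λ { zero → ∷-In has1 (λ _ → has0) ; (suc i) → ∷-In has0 (coord-In i) }
      ; coord-indep = indep-echelon _ coord coord-indep
      ; factorisation = λ
          { zero    → symV (transV (+V-cong (·V-identityˡ _) (lincomb-zeroˡ basis)) (+V-identityʳ _))
          ; (suc j) → transV (factorisation j)
                        (symV (transV (+V-cong (·V-zeroˡ _) reflV) (+V-identityˡ _))) }
      ; kernel = λ i → 0# ∷ kernel i ; kernel-In = λ i → ∷-In has0 (kernel-In i)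
      ; kernel-indep = indep-prefix (λ _ → 0#) kernel kernel-indep
      ; kernel-relation = λ i → transV (+V-cong (·V-zeroˡ _) (kernel-relation i)) (+V-identityˡ _)
      ; kernel-complete = complete }
      where
      open RankData r
      complete : ∀ c → (∀ j → In (c j)) → lincomb S c y ≈V 0V →
        Span (Vsp (suc n)) In (λ i → 0# ∷ kernel i) c
      complete c c∈ e with c zero ≟ 0#
      -- A nonzero leading coefficient would express `y zero` by the other generators.
      ... | no nz = ⊥-elim (y₀∉ (relation⇒∈span {v = y} c∈ e nz))
      ... | yes z =
        let d , d∈ , p = kernel-complete (c ∘ suc) (c∈ ∘ suc)
              (transV (symV (transV (+V-cong (transV (·V-cong z reflV) (·V-zeroˡ _)) reflV)
                                    (+V-identityˡ _))) e)
        in d , d∈ , λ { zero    → trans z (sym (eval-head-0 d kernel))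
                      ; (suc j) → trans (p j) (sym (eval-tail (λ _ → 0#) d kernel j)) }

-- Arithmetic of the parameters: ceilings, divisibility and the two quasi-MRD distances.

module Arithmetic where

  -- The numerator in the ceiling is `a + n - 1`, and it equals `r + c n` with remainder `r < n`.
  -- Adding 1 to both sides avoids truncated subtraction.
  ceil-unique : ∀ {a r c} n → r ℕ.< n → a ℕ.+ n ≡ suc r ℕ.+ c ℕ.* n → ⌈ a / n ⌉ ≡ c
  ceil-unique {a} {r} {c} (suc n) r<n eq = begin
      (a ℕ.+ n) ℕ./ suc n                        ≡⟨ ≡.cong (ℕ._/ suc n) a+n≡ ⟩
      (r ℕ.+ c ℕ.* suc n) ℕ./ suc n              ≡⟨ +-distrib-/-∣ʳ r (n∣m*n c) ⟩
      r ℕ./ suc n ℕ.+ (c ℕ.* suc n) ℕ./ suc n    ≡⟨ ≡.cong₂ ℕ._+_ (m<n⇒m/n≡0 r<n) (m*n/n≡m c (suc n)) ⟩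
      c                                          ∎
    where
    open ≡.≡-Reasoning
    a+n≡ : a ℕ.+ n ≡ r ℕ.+ c ℕ.* suc n
    a+n≡ = ℕ.suc-injective (≡.trans (≡.sym (ℕ.+-suc a n)) eq)

  module Parameters (m k' ρ : ℕ) (1≤ρ : 1 ℕ.≤ ρ) (ρk<m : ρ ℕ.* suc k' ℕ.< m) where
    k n : ℕ
    k = suc (suc k')
    n = m ℕ.+ ρ

    k≤m : k ℕ.≤ m
    k≤m = ℕ.≤-trans (ℕ.s≤s (≡.subst (ℕ._≤ ρ ℕ.* suc k') (ℕ.*-identityˡ (suc k'))
            (ℕ.*-monoˡ-≤ (suc k') 1≤ρ))) ρk<m

    k≤n : k ℕ.≤ n
    k≤n = ℕ.≤-trans k≤m (ℕ.m≤m+n m ρ)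

    m<n : m ℕ.< n
    m<n = ℕ.m<m+n m 1≤ρ

    1≤kρ : 1 ℕ.≤ k ℕ.* ρ
    1≤kρ = ℕ.≤-trans 1≤ρ (ℕ.m≤m+n ρ _)

    -- kρ = ρ + ρ(k-1) < ρ + m.
    kρ<n : k ℕ.* ρ ℕ.< n
    kρ<n = ≡.subst₂ ℕ._<_ (≡.cong (ρ ℕ.+_) (ℕ.*-comm ρ (suc k'))) (ℕ.+-comm ρ m)
      (ℕ.+-monoʳ-< ρ ρk<m)

    n∤kρ : ¬ (n ∣ k ℕ.* ρ)
    n∤kρ n∣kρ with k ℕ.* ρ | 1≤kρ | kρ<n
    ... | suc x | _ | x<n = ℕ.<⇒≱ x<n (∣⇒≤ n∣kρ)

    -- Since nk = mk + kρ, divisibility would pass to kρ, which lies strictly between 0 and n.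
    n∤mk : ¬ (n ∣ m ℕ.* k)
    n∤mk n∣mk = n∤kρ (∣m+n∣m⇒∣n (≡.subst (n ∣_) (eq m k ρ) (n∣m*n k)) n∣mk)
      where
      eq : ∀ m k ρ → k ℕ.* (m ℕ.+ ρ) ≡ m ℕ.* k ℕ.+ k ℕ.* ρ
      eq = solve-∀

    n∤m[n∸k] : ¬ (n ∣ m ℕ.* (n ℕ.∸ k))
    n∤m[n∸k] n∣ = n∤mk (∣m+n∣m⇒∣n (≡.subst (n ∣_) eq (n∣m*n m)) n∣)
      where
      eq : m ℕ.* n ≡ m ℕ.* (n ℕ.∸ k) ℕ.+ m ℕ.* k
      eq = ≡.trans (≡.cong (m ℕ.*_) (≡.sym (ℕ.m∸n+n≡m k≤n))) (ℕ.*-distribˡ-+ m (n ℕ.∸ k) k)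

    ceil-code : ⌈ k ℕ.* m / n ⌉ ≡ k
    -- From km = kn - kρ one gets km + n = (n - kρ) + kn, so the remainder is n - kρ - 1.
    ceil-code = ceil-unique {r = n ℕ.∸ suc (k ℕ.* ρ)} n
      (ℕ.∸-monoʳ-< {o = 0} (ℕ.s≤s ℕ.z≤n) kρ<n) (begin
        k ℕ.* m ℕ.+ n                                  ≡⟨ ≡.cong (k ℕ.* m ℕ.+_) (ℕ.m∸n+n≡m kρ<n) ⟨
        k ℕ.* m ℕ.+ (r ℕ.+ suc (k ℕ.* ρ))              ≡⟨ eq (k ℕ.* m) r (k ℕ.* ρ) ⟩
        suc r ℕ.+ (k ℕ.* m ℕ.+ k ℕ.* ρ)                ≡⟨ ≡.cong (suc r ℕ.+_) (ℕ.*-distribˡ-+ k m ρ) ⟨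
        suc r ℕ.+ k ℕ.* n                              ∎)
      where
      open ≡.≡-Reasoning
      r = n ℕ.∸ suc (k ℕ.* ρ)
      eq : ∀ x r y → x ℕ.+ (r ℕ.+ suc y) ≡ suc r ℕ.+ (x ℕ.+ y)
      eq = solve-∀

    ceil-dual : ⌈ (n ℕ.∸ k) ℕ.* m / n ⌉ ≡ m ℕ.∸ suc k'
    -- With s = m - k, the product (n-k)m is (s+ρ)(k+s), and adding n gives kρ + (s+1)n. The
    -- remainder is therefore kρ - 1 and the quotient s + 1 = m - k + 1.
    ceil-dual = ceil-unique {r = ℕ.pred (k ℕ.* ρ)} n (ℕ.≤-<-trans ℕ.pred[n]≤n kρ<n) (begin
        (n ℕ.∸ k) ℕ.* m ℕ.+ n                   ≡⟨ ≡.cong (λ x → x ℕ.* m ℕ.+ n) n∸k≡ ⟩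
        (s ℕ.+ ρ) ℕ.* m ℕ.+ (m ℕ.+ ρ)           ≡⟨ ≡.cong (λ x → (s ℕ.+ ρ) ℕ.* x ℕ.+ (x ℕ.+ ρ)) m≡ ⟩
        (s ℕ.+ ρ) ℕ.* (k ℕ.+ s) ℕ.+ (k ℕ.+ s ℕ.+ ρ)
                                                ≡⟨ eq s ρ k' ⟩
        k ℕ.* ρ ℕ.+ suc s ℕ.* (k ℕ.+ s ℕ.+ ρ)   ≡⟨ ≡.cong (λ x → k ℕ.* ρ ℕ.+ suc s ℕ.* (x ℕ.+ ρ)) m≡ ⟨
        k ℕ.* ρ ℕ.+ suc s ℕ.* n                 ≡⟨ ≡.cong (λ x → k ℕ.* ρ ℕ.+ x ℕ.* n) m∸≡ ⟨
        k ℕ.* ρ ℕ.+ (m ℕ.∸ suc k') ℕ.* n        ≡⟨ ≡.cong (ℕ._+ (m ℕ.∸ suc k') ℕ.* n) (suc-pred 1≤kρ) ⟨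
        suc (ℕ.pred (k ℕ.* ρ)) ℕ.+ (m ℕ.∸ suc k') ℕ.* n ∎)
      where
      open ≡.≡-Reasoning
      s = m ℕ.∸ k
      m≡ : m ≡ k ℕ.+ s
      m≡ = ≡.sym (ℕ.m+[n∸m]≡n k≤m)
      n∸k≡ : n ℕ.∸ k ≡ s ℕ.+ ρ
      n∸k≡ = ℕ.+-∸-comm ρ k≤m
      m∸≡ : m ℕ.∸ suc k' ≡ suc s
      m∸≡ = ≡.trans (≡.cong (ℕ._∸ suc k') (≡.trans m≡ (≡.sym (ℕ.+-suc (suc k') s))))
              (ℕ.m+n∸m≡n (suc k') (suc s))
      suc-pred : ∀ {x} → 1 ℕ.≤ x → suc (ℕ.pred x) ≡ x
      suc-pred (ℕ.s≤s _) = ≡.refl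
      eq : ∀ s ρ k' → (s ℕ.+ ρ) ℕ.* (suc (suc k') ℕ.+ s) ℕ.+ (suc (suc k') ℕ.+ s ℕ.+ ρ) ≡
                      suc (suc k') ℕ.* ρ ℕ.+ suc s ℕ.* (suc (suc k') ℕ.+ s ℕ.+ ρ)
      eq = solve-∀

    dist-code : (m ℕ.∸ ⌈ k ℕ.* m / n ⌉) ℕ.+ 1 ≡ suc (m ℕ.∸ k)
    dist-code = ≡.trans (ℕ.+-comm _ 1) (≡.cong (λ x → suc (m ℕ.∸ x)) ceil-code)

    dist-dual : (m ℕ.∸ ⌈ (n ℕ.∸ k) ℕ.* m / n ⌉) ℕ.+ 1 ≡ k
    dist-dual = ≡.trans (ℕ.+-comm _ 1) (≡.cong suc
      (≡.trans (≡.cong (m ℕ.∸_) ceil-dual) (ℕ.m∸[m∸n]≡n (ℕ.<⇒≤ k≤m))))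

    dist+section≡n : suc (m ℕ.∸ k) ℕ.+ (ρ ℕ.+ suc k') ≡ n
    dist+section≡n = ≡.trans (eq (m ℕ.∸ k) ρ k') (≡.cong (ℕ._+ ρ) (ℕ.m+[n∸m]≡n k≤m))
      where
      eq : ∀ s ρ k' → suc s ℕ.+ (ρ ℕ.+ suc k') ≡ suc (suc k') ℕ.+ s ℕ.+ ρ
      eq = solve-∀

    nk≡km+kρ : n ℕ.* k ≡ k ℕ.* m ℕ.+ k ℕ.* ρ
    nk≡km+kρ = ≡.trans (ℕ.*-comm n k) (ℕ.*-distribˡ-+ k m ρ)

  -- Here `w` will be a weight and `a` the dimension of the matching hyperplane section. Their sum
  -- is fixed, so a lower bound on one is an upper bound on the other.
  complement-≤ : ∀ {w a d b} → w ℕ.+ a ≡ d ℕ.+ b → d ℕ.≤ w → a ℕ.≤ b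
  complement-≤ {w} {a} {d} {b} eq d≤w =
    ℕ.+-cancelˡ-≤ d a b (ℕ.≤-trans (ℕ.+-monoˡ-≤ a d≤w) (ℕ.≤-reflexive eq))

  complement-≥ : ∀ {w a d b} → w ℕ.+ a ≡ d ℕ.+ b → a ℕ.≤ b → d ℕ.≤ w
  complement-≥ {w} {a} {d} {b} eq a≤b =
    ℕ.+-cancelʳ-≤ b d w (ℕ.≤-trans (ℕ.≤-reflexive (≡.sym eq)) (ℕ.+-monoʳ-≤ w a≤b))

  -- The values of `IsEpsT` are integers while dimensions are natural numbers; this and the next
  -- lemmas carry the subtracted dimension across.
  [a+b]-b : ∀ a b → + (a ℕ.+ b) ℤ.- + b ≡ + a
  [a+b]-b a b = ≡.trans (ℤ.m-n≡m⊖n (a ℕ.+ b) b)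
    (≡.trans (ℤ.⊖-≥ (ℕ.m≤n+m b a)) (≡.cong +_ (ℕ.m+n∸n≡m a b)))

  ≤⇒-≤ : ∀ {a b c} → a ℕ.≤ c ℕ.+ b → + a ℤ.- + b ℤ.≤ + c
  ≤⇒-≤ {a} {b} {c} a≤ = ≡.subst (+ a ℤ.- + b ℤ.≤_) ([a+b]-b c b) (ℤ.+-monoˡ-≤ (ℤ.- + b) (ℤ.+≤+ a≤))

  [a-b]+b : ∀ a b → (+ a ℤ.- + b) ℤ.+ + b ≡ + a
  [a-b]+b a b = ≡.trans (ℤ.+-assoc (+ a) (ℤ.- + b) (+ b))
    (≡.trans (≡.cong (λ z → + a ℤ.+ z) (ℤ.+-inverseˡ (+ b))) (ℤ.+-identityʳ (+ a)))

  -≤⇒≤ : ∀ {a b c} → + a ℤ.- + b ℤ.≤ + c → a ℕ.≤ c ℕ.+ b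
  -≤⇒≤ {a} {b} h = ℤ.drop‿+≤+ (≡.subst (ℤ._≤ _) ([a-b]+b a b) (ℤ.+-monoˡ-≤ (+ b) h))

  -≡⇒≡ : ∀ {a b c} → + c ≡ + a ℤ.- + b → a ≡ c ℕ.+ b
  -≡⇒≡ {a} {b} eq = ≡.sym (ℤ.+-injective (≡.trans (≡.cong (ℤ._+ + b) eq) ([a-b]+b a b)))

-- The extension of L over K: hyperplanes, rank weights and parity checks.

module Extension (F : Field) (K : Over.Subfield F) (m : ℕ) (degree : Over.Codes.IsDegree F K m) where
  open Over F
  open VectorSpaces F
  open Field F using (commRing)
  open CommutativeRing commRing hiding (zero)
  open Subfield K using (In)
  open Codes K m

  private
    module DL = Scalars.Dimension F K Lsp-isVectorSpace
    module LL = LinearCombinations Lsp-isVectorSpace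

  L-spanned : ∀ x → Span Lsp In (proj₁ (proj₁ degree)) x
  L-spanned x = DL.maximal⇒spans {W = λ _ → ⊤} (proj₁ (proj₂ (proj₁ degree)))
                  (proj₂ (proj₂ (proj₁ degree))) (proj₂ degree) tt

  -- L as a subfield of itself, finite because K-coordinates in a basis of length `m` enumerate it.
  -- With this instance all the linear algebra over K is available over L as well.
  full : Subfield
  full = record
    { In = AllL ; resp = λ _ _ → tt ; has0 = tt ; has1 = tt ; +-closed = λ _ _ → tt
    ; neg-closed = λ _ → tt ; *-closed = λ _ _ → tt ; inv-closed = λ _ _ → tt
    ; finite = _ , (λ i → lincomb Lsp (Scalars.tuple F K m i) (proj₁ (proj₁ degree))) , (λ _ → tt) , λ x _ →
        let c , c∈ , x≈ = L-spanned x
            i , c≈ = Scalars.tuple-surjective F K c c∈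
        in i , trans x≈ (LL.lincomb-congˡ c≈) }

  private
    module SK = Scalars F K
    module SL = Scalars F full
    module RK = Rank.RankNullity F K Lsp-isVectorSpace
    module RL = Rank.RankNullity F full Lsp-isVectorSpace
    module DLL = SL.Dimension Lsp-isVectorSpace
    module CV {t} = LinearCombinations (Vsp-isVectorSpace t)
    module DVK {t} = SK.Dimension (Vsp-isVectorSpace t)
    module DVL {t} = SL.Dimension (Vsp-isVectorSpace t)

  Hyperplane : ∀ {t} → (Fin t → Carrier) → Pred (Fin t → Carrier) 0ℓ
  Hyperplane x z = dot z x ≈ 0#

  hyperplane-isSubspace : ∀ {t} (x : Fin t → Carrier) {P} → IsSubspace (Vsp t) P (Hyperplane x)
  hyperplane-isSubspace x =
    LL.lincomb-zeroˡ x ,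
    (λ {y} {z} p q → trans (LL.lincomb-+ˡ y z x) (trans (+-cong p q) (+-identityˡ 0#))) ,
    (λ {c} {y} _ p → trans (LL.lincomb-*ˡ c y x) (trans (*-congˡ p) (zeroʳ c))) ,
    (λ y≈z p → trans (LL.lincomb-congˡ (λ i → sym (y≈z i))) p)

  -- L is spanned over itself by 1, which bounds the rank by 1; rank 0 would factor `x` through the
  -- empty family and make it zero.
  rank-nonzero : ∀ {t} {x : Fin t → Carrier} → NonZero x → (r : RL.RankData x) →
    RL.RankData.rank r ≡ 1
  rank-nonzero {t} {x} x≢0 r = ℕ.≤-antisym
      (DLL.indep≤ {W = λ _ → ⊤} (basis , (λ _ → tt) , basis-indep)
        (DLL.spanned⇒dim≤ {W = λ _ → ⊤} {v = λ (_ : Fin 1) → 1#}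
          (λ {z} _ → (λ _ → z) , (λ _ → tt) , sym (trans (+-identityʳ _) (*-identityʳ z)))))
      (positive rank basis coord factorisation)
    where
    open RL.RankData r
    positive : ∀ r (b : Fin r → Carrier) (c : Fin r → Fin t → Carrier) →
      (∀ j → x j ≈ lincomb Lsp (λ i → c i j) b) → 1 ℕ.≤ r
    positive zero    b c x≈ = ⊥-elim (x≢0 x≈)
    positive (suc _) b c x≈ = ℕ.s≤s ℕ.z≤n

  hyperplane-dim : ∀ {t} {x : Fin (suc t) → Carrier} → NonZero x →
    HasDim (Vsp (suc t)) AllL (Hyperplane x) t
  hyperplane-dim {t} {x} x≢0 = ≡.subst (HasDim (Vsp (suc t)) AllL (Hyperplane x)) nullity≡t
      (DVL.basis⇒dim {W = Hyperplane x} kernel-relation kernel-indep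
        (λ {z} p → kernel-complete z (λ _ → tt) p))
    where
    r = RL.rankData x
    open RL.RankData r
    nullity≡t : nullity ≡ t
    nullity≡t = ℕ.suc-injective (≡.trans (≡.cong (ℕ._+ nullity) (≡.sym (rank-nonzero x≢0 r))) rank+nullity)

  -- The `t + 1` columns of the matrix `v` lie in L^t and are thus dependent; the coefficients of a
  -- relation form the normal vector.
  hyperplane-through : ∀ {t} (v : Fin t → Fin (suc t) → Carrier) →
    ∃ λ x → NonZero x × ∀ i → Hyperplane x (v i)
  hyperplane-through v =
    let c , _ , e , i , c≉0 = DVL.steinitz (Rank.std F full) (λ j i → v i j)
                                (λ j → Rank.std-spans F full (λ i → v i j))
    in c , (λ z → c≉0 (z i)) ,
       λ i → trans (lincomb-swap (v i) c) (trans (sym (eval-lincomb c (λ j i → v i j) i)) (e i))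

  abstract
    -- A basis of `T` lies in some hyperplane of the same dimension, so it spans both.
    codim1⇒hyperplane : ∀ {t} {T : Pred (Fin (suc t) → Carrier) 0ℓ} →
      IsSubspace (Vsp (suc t)) AllL T → HasDim (Vsp (suc t)) AllL T t →
      ∃ λ x → NonZero x × T ⊆ Hyperplane x × Hyperplane x ⊆ T
    codim1⇒hyperplane {T = T} T-sub ((v , v∈ , v-ind) , dim≤) with hyperplane-through v
    ... | x , x≢0 , v⊥x = x , x≢0 ,
      (λ {z} z∈ → DVL.span⊆ {W = Hyperplane x} (hyperplane-isSubspace x) v⊥x
                    (DVL.maximal⇒spans {W = T} v∈ v-ind dim≤ z∈)) ,
      (λ {z} z∈ → DVL.span⊆ {W = T} T-sub v∈
                    (DVL.maximal⇒spans {W = Hyperplane x} v⊥x v-ind (proj₂ (hyperplane-dim x≢0)) z∈))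

  abstract
    weight : ∀ {n} → (Fin n → Carrier) → ℕ
    weight y = RK.RankData.rank (RK.rankData y)

    hasRankWeight : ∀ {n} (y : Fin n → Carrier) → HasRankWeight y (weight y)
    hasRankWeight y = RK.RankData.span-dim (RK.rankData y)

  hasRankWeight-unique : ∀ {n} (y : Fin n → Carrier) {w} → HasRankWeight y w → weight y ≡ w
  hasRankWeight-unique y = DL.dim-unique {W = Span Lsp In y} {W' = Span Lsp In y} (λ p → p) (λ p → p) (hasRankWeight y)

  weight≤ : ∀ {n d} (y : Fin n → Carrier) (b : Fin d → Carrier) → (∀ j → Span Lsp In b (y j)) →
    weight y ℕ.≤ d
  weight≤ y b y∈ = DL.indep≤ {W = Span Lsp In y} (proj₁ (hasRankWeight y))
    (DL.spanned⇒dim≤ {W = Span Lsp In y} (DL.span⊆ (DL.span-isSubspace b) y∈))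

  weight-cong : ∀ {n} {y z : Fin n → Carrier} → (∀ j → y j ≈ z j) → weight y ≡ weight z
  weight-cong {n} {y} {z} y≈z = DL.dim-unique {W = Span Lsp In y} {W' = Span Lsp In z}
      (resp y≈z) (resp (λ j → sym (y≈z j))) (hasRankWeight y) (hasRankWeight z)
    where
    resp : ∀ {y z : Fin n → Carrier} → (∀ j → y j ≈ z j) → Span Lsp In y ⊆ Span Lsp In z
    resp y≈z (c , c∈ , p) = c , c∈ , trans p (LL.lincomb-congʳ y≈z)

  Rows⊥ : ∀ {t n} → (Fin t → Fin n → Carrier) → Pred (Fin n → Carrier) 0ℓ
  Rows⊥ R y = ∀ i → Hyperplane (R i) y

  -- The values `dot (v j) x` lie in L, of dimension `m` over K, so this K-linear map has rank at
  -- most `m` and at least `N` independent kernel vectors.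
  hasIndep-∩-hyperplane : ∀ {n N} {W : Pred (Fin n → Carrier) 0ℓ} → IsSubspace (Vsp n) In W →
    ∀ x → HasIndep (Vsp n) In W (m ℕ.+ N) → HasIndep (Vsp n) In (W ∩ Hyperplane x) N
  hasIndep-∩-hyperplane {N = N} {W} W-sub x (v , v∈ , v-ind) =
    DVK.hasIndep-≤ {W = W ∩ Hyperplane x} N≤nullity
      ( (λ i → lincomb (Vsp _) (kernel i) v)
      , (λ i → DVK.lincomb∈ {W = W} W-sub (kernel-In i) v∈ ,
               trans (sym (LL.lincomb-assoc (kernel i) v x)) (kernel-relation i))
      , DVK.combinations-indep v-ind kernel-In kernel-indep )
    where
    open RK.RankData (RK.rankData (λ j → dot (v j) x))
    rank≤m : rank ℕ.≤ m
    rank≤m = DL.indep≤ {W = λ _ → ⊤} (basis , (λ _ → tt) , basis-indep) (proj₂ degree)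
    N≤nullity : N ℕ.≤ nullity
    N≤nullity = ℕ.+-cancelˡ-≤ m N nullity (ℕ.≤-trans (ℕ.≤-reflexive (≡.sym rank+nullity))
                  (ℕ.+-monoˡ-≤ nullity rank≤m))

  hasIndep-∩-rows⊥ : ∀ {t n N} {W : Pred (Fin n → Carrier) 0ℓ} → IsSubspace (Vsp n) In W →
    (R : Fin t → Fin n → Carrier) → HasIndep (Vsp n) In W (t ℕ.* m ℕ.+ N) →
    HasIndep (Vsp n) In (W ∩ Rows⊥ R) N
  hasIndep-∩-rows⊥ {zero} W-sub R (v , v∈ , ind) = v , (λ i → v∈ i , λ ()) , ind
  hasIndep-∩-rows⊥ {suc t} {n} {N} {W} W-sub@(0∈ , +∈ , ·∈ , resp∈) R h =
    let v , v∈ , ind = hasIndep-∩-rows⊥ {W = W ∩ Hyperplane (R zero)} sub (R ∘ suc)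
          (hasIndep-∩-hyperplane {W = W} W-sub (R zero)
            (≡.subst (HasIndep (Vsp n) In W) (ℕ.+-assoc m (t ℕ.* m) N) h))
    in v , (λ i → proj₁ (proj₁ (v∈ i)) , λ { zero → proj₂ (proj₁ (v∈ i)) ; (suc j) → proj₂ (v∈ i) j }) , ind
    where
    sub : IsSubspace (Vsp n) In (W ∩ Hyperplane (R zero))
    sub = let 0∈' , +∈' , ·∈' , resp∈' = hyperplane-isSubspace (R zero) {In} in
      (0∈ , 0∈') , (λ (p , p') (q , q') → +∈ p q , +∈' {x = _} {y = _} p' q') ,
      (λ {c} {x} c∈ (p , p') → ·∈ c∈ p , ·∈' {c = c} {x = x} c∈ p') ,
      (λ {x} {y} e (p , p') → resp∈ e p , resp∈' {x = x} {y = y} e p')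

  row∈Code : ∀ {k n} (G : Fin k → Fin n → Carrier) i → Code G (G i)
  row∈Code G = DVL.generator∈span G

  rows⊥⇒Dual : ∀ {k n} {G : Fin k → Fin n → Carrier} {y} → Rows⊥ G y → Dual (Code G) y
  rows⊥⇒Dual {G = G} {y} y⊥ c (a , _ , c≈) = trans (LL.lincomb-congˡ c≈)
    (trans (sym (LL.lincomb-assoc a G y))
      (trans (LL.lincomb-congʳ (λ i → trans (lincomb-swap (G i) y) (y⊥ i))) (LL.lincomb-zeroʳ a)))

  -- Dual codewords are exactly the L-linear relations among the columns of `G`, that is, among the
  -- generators of the system.
  columns⊥⇔Dual : ∀ {k n} (G : Fin k → Fin n → Carrier) (y : Fin n → Carrier) →
    (∀ i → lincomb (Vsp k) y (λ j i → G i j) i ≈ 0#) ⇔ Dual (Code G) y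
  columns⊥⇔Dual G y = mk⇔
    (λ e → rows⊥⇒Dual (λ i → trans (sym (eval-lincomb y (λ j i → G i j) i)) (e i)))
    (λ y⊥ i → trans (eval-lincomb y (λ j i → G i j) i)
                (trans (lincomb-swap y (G i)) (y⊥ (G i) (row∈Code G i))))

  -- Expanding the coefficients `α` in a K-basis of their span splits a relation over L into one
  -- relation over K for each basis element; each of these is trivial.
  indepK⇒indepL : ∀ {d t} {M : Fin d → Fin t → Carrier} → (∀ i j → In (M i j)) →
    LinIndep (Vsp t) In M → LinIndep (Vsp t) AllL M
  indepK⇒indepL {d} {t} {M} M∈ M-ind α _ e i =
    trans (factorisation i) (trans (LL.lincomb-congˡ (λ s → coord≈0 s i)) (LL.lincomb-zeroˡ basis))
    where
    open RK.RankData (RK.rankData α)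
    expand : ∀ j → lincomb Lsp (λ s → lincomb (Vsp t) (coord s) M j) basis ≈ 0#
    expand j = trans (lincomb-swap _ basis)
      (trans (sym (eval-lincomb basis (λ s → lincomb (Vsp t) (coord s) M) j))
      (trans (CV.lincomb-assoc basis coord M j)
      (trans (CV.lincomb-congˡ {v = M} (λ i → trans (eval-lincomb basis coord i)
        (trans (lincomb-swap basis (λ s → coord s i)) (sym (factorisation i)))) j) (e j))))
    coord≈0 : ∀ s i → coord s i ≈ 0#
    coord≈0 s = M-ind (coord s) (coord-In s) (λ j → basis-indep _
      (λ s → SK.lincombV-In (coord-In s) M∈ j) (expand j) s)

-- Codewords and hyperplane sections of U: the criterion for the code itself.

module RankMetricCode (F : Field) (K : Over.Subfield F) (m : ℕ) (degree : Over.Codes.IsDegree F K m)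
  (k' ρ : ℕ) (1≤ρ : 1 ℕ.≤ ρ) (ρk<m : ρ ℕ.* suc k' ℕ.< m)
  (G : Fin (suc (suc k')) → Fin (m ℕ.+ ρ) → Field.Carrier F)
  (rows-indep : Over.LinIndep F (Over.Vsp F (m ℕ.+ ρ)) (Over.AllL F) G)
  (columns-indep : Over.Codes.ColumnsIndepK F K m G) where
  open Over F
  open VectorSpaces F
  open Field F using (commRing; _≟_; 0≉1)
  open CommutativeRing commRing hiding (zero)
  open Subfield K using (In; has1)
  open Codes K m
  open Extension F K m degree
  open Arithmetic
  open Parameters m k' ρ 1≤ρ ρk<m

  private
    module LL = LinearCombinations Lsp-isVectorSpace
    module CV {t} = LinearCombinations (Vsp-isVectorSpace t)
    module DL = Scalars.Dimension F K Lsp-isVectorSpace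
    module DVK {t} = Scalars.Dimension F K (Vsp-isVectorSpace t)
    module DVL {t} = Scalars.Dimension F full (Vsp-isVectorSpace t)
    module RK = Rank.RankNullity F K Lsp-isVectorSpace
    module RVL {t} = Rank.RankNullity F full (Vsp-isVectorSpace t)

    g : Fin n → Fin k → Carrier
    g j i = G i j

    U : Pred (Fin k → Carrier) 0ℓ
    U = System G

  U-hasIndep : HasIndep (Vsp k) In U n
  U-hasIndep = g , DVK.generator∈span g , columns-indep

  codeword : (Fin k → Carrier) → Fin n → Carrier
  codeword x = lincomb (Vsp n) x G

  codeword∈Code : ∀ x → Code G (codeword x)
  codeword∈Code x = x , (λ _ → tt) , λ _ → refl

  codeword-nonZero : ∀ {x} → NonZero x → NonZero (codeword x)
  codeword-nonZero {x} x≢0 e = x≢0 (rows-indep x (λ _ → tt) e)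

  coefficients-nonZero : ∀ {x c} → (∀ j → c j ≈ codeword x j) → NonZero c → NonZero x
  coefficients-nonZero c≈ c≢0 x≈0 = c≢0 (λ j → trans (c≈ j)
    (trans (CV.lincomb-congˡ {v = G} x≈0 j) (CV.lincomb-zeroˡ G j)))

  abstract
    -- For c in K^n the value c · (xG) equals (Gc) · x, so the K-relations among the entries of the
    -- codeword correspond to the vectors Gc of `U` in the hyperplane.
    section-dim : ∀ x → ∃ λ a → HasDim (Vsp k) In (U ∩ Hyperplane x) a × weight (codeword x) ℕ.+ a ≡ n
    section-dim x = nullity , kernel-transport-dim (Vsp-isVectorSpace k) g columns-indep (Hyperplane x)
        (λ c c∈ e → trans (sym (dot-codeword c)) e)
        (λ c c∈ z z⊥x z≈ → trans (dot-codeword c) (trans (LL.lincomb-congˡ {v = x} (λ i → sym (z≈ i))) z⊥x)) ,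
        ≡.trans (≡.cong (ℕ._+ nullity) (hasRankWeight-unique (codeword x) span-dim)) rank+nullity
      where
      open RK.RankData (RK.rankData (codeword x))
      dot-codeword : ∀ c → lincomb Lsp c (codeword x) ≈ dot (lincomb (Vsp k) c g) x
      dot-codeword c = trans
        (LL.lincomb-congʳ (λ j → trans (eval-lincomb x G j) (lincomb-swap x (g j))))
        (LL.lincomb-assoc c g x)

  -- The right side splits n into the quasi-MRD distance m-k+1 and the section dimension ρ+k-1 that
  -- belongs to the value ρ of ε.
  weight+section : ∀ x {a} → HasDim (Vsp k) In (U ∩ Hyperplane x) a →
    weight (codeword x) ℕ.+ a ≡ suc (m ℕ.∸ k) ℕ.+ (ρ ℕ.+ suc k')
  weight+section x {a} dim-a =
    let a' , dim-a' , eq = section-dim x in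
    ≡.trans (≡.cong (weight (codeword x) ℕ.+_)
      (DVK.dim-unique {W = U ∩ Hyperplane x} {W' = U ∩ Hyperplane x} (λ p → p) (λ p → p) dim-a dim-a'))
      (≡.trans eq (≡.sym dist+section≡n))

  -- A codeword of minimum weight yields a hyperplane attaining ρ. Any other `T` is again some
  -- hyperplane `z^⊥`, and the weight bound for the codeword of `z` bounds its section.
  minDist⇒eps : HasMinDist (Code G) (suc (m ℕ.∸ k)) → IsEps U (suc k') (+ ρ)
  minDist⇒eps ((c , (x , _ , c≈) , c≢0 , c-weight) , minimal) =
      (Hyperplane x , hyperplane-isSubspace x , hyperplane-dim {x = x} x≢0 ,
        a , suc k' , dim-a , hyperplane-dim {x = x} x≢0 ,
        ≡.trans (≡.sym ([a+b]-b ρ (suc k'))) (≡.cong (λ z → + z ℤ.- + suc k') (≡.sym a≡))) ,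
      upper
    where
    x≢0 = coefficients-nonZero {x} c≈ c≢0
    a = proj₁ (section-dim x)
    dim-a = proj₁ (proj₂ (section-dim x))
    a≡ : a ≡ ρ ℕ.+ suc k'
    a≡ = ℕ.+-cancelˡ-≡ (suc (m ℕ.∸ k)) a (ρ ℕ.+ suc k')
      (≡.trans (≡.cong (ℕ._+ a) (≡.sym (≡.trans (weight-cong (λ j → sym (c≈ j)))
                                              (hasRankWeight-unique c c-weight))))
        (weight+section x dim-a))
    upper : ∀ T → IsSubspace (Vsp k) AllL T → HasDim (Vsp k) AllL T (suc k') →
      ∀ e → IsEpsT U T e → e ℤ.≤ + ρ
    upper T T-sub T-dim e (a' , b , dim-a' , T-dim' , e≡) =
      let z , z≢0 , T⊆z , _ = codim1⇒hyperplane {T = T} T-sub T-dim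
          _ , dim-z , _ = section-dim z
      -- `IsEpsT` brings its own dimension `b` for `T`; uniqueness identifies it with k-1.
      in ≡.subst (ℤ._≤ + ρ) (≡.sym e≡) (≤⇒-≤ (≡.subst (λ b → a' ℕ.≤ ρ ℕ.+ b)
          (DVL.dim-unique {W = T} {W' = T} (λ p → p) (λ p → p) T-dim T-dim')
          (ℕ.≤-trans
            (DVK.dim-⊆ {W = U ∩ T} {W' = U ∩ Hyperplane z} (λ (u , t) → u , T⊆z t) dim-a' dim-z)
            (complement-≤ {d = suc (m ℕ.∸ k)} (weight+section z dim-z)
              (minimal _ _ (codeword∈Code z) (codeword-nonZero {z} z≢0) (hasRankWeight (codeword z)))))))

  -- The same correspondence backwards: a maximising `T` is a hyperplane whose normal vector gives a
  -- codeword of weight m-k+1, and maximality bounds all other weights from below.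
  eps⇒minDist : IsEps U (suc k') (+ ρ) → HasMinDist (Code G) (suc (m ℕ.∸ k))
  eps⇒minDist ((T , T-sub , T-dim , a , b , dim-a , T-dim' , ρ≡) , upper) =
      (codeword x , codeword∈Code x , codeword-nonZero {x} x≢0 ,
        ≡.subst (HasRankWeight (codeword x)) weight≡ (hasRankWeight (codeword x))) ,
      minimal
    where
    hyperplane = codim1⇒hyperplane {T = T} T-sub T-dim
    x = proj₁ hyperplane
    x≢0 = proj₁ (proj₂ hyperplane)
    T⊆x : T ⊆ Hyperplane x
    T⊆x = proj₁ (proj₂ (proj₂ hyperplane))
    x⊆T : Hyperplane x ⊆ T
    x⊆T = proj₂ (proj₂ (proj₂ hyperplane))
    a' = proj₁ (section-dim x)
    dim-a' = proj₁ (proj₂ (section-dim x))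
    a'≡ : a' ≡ ρ ℕ.+ suc k'
    a'≡ = ≡.trans (DVK.dim-unique {W = U ∩ Hyperplane x} {W' = U ∩ T}
            (λ (u , t) → u , x⊆T t) (λ (u , t) → u , T⊆x t) dim-a' dim-a)
            (≡.trans (-≡⇒≡ ρ≡) (≡.cong (ρ ℕ.+_)
              (DVL.dim-unique {W = T} {W' = T} (λ p → p) (λ p → p) T-dim' T-dim)))
    weight≡ : weight (codeword x) ≡ suc (m ℕ.∸ k)
    weight≡ = ℕ.+-cancelʳ-≡ (ρ ℕ.+ suc k') _ _
      (≡.trans (≡.cong (weight (codeword x) ℕ.+_) (≡.sym a'≡)) (weight+section x dim-a'))
    minimal : ∀ c w → Code G c → NonZero c → HasRankWeight c w → suc (m ℕ.∸ k) ℕ.≤ w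
    minimal c w (z , _ , c≈) c≢0 c-weight =
      ≡.subst (suc (m ℕ.∸ k) ℕ.≤_)
        (≡.trans (weight-cong (λ j → sym (c≈ j))) (hasRankWeight-unique c c-weight))
        (complement-≥ {b = ρ ℕ.+ suc k'} (weight+section z dim-z) (-≤⇒≤ (upper (Hyperplane z) (hyperplane-isSubspace z)
          (hyperplane-dim {x = z} z≢0) _ (_ , _ , dim-z , hyperplane-dim {x = z} z≢0 , ≡.refl))))
      where
      z≢0 = coefficients-nonZero {z} c≈ c≢0
      dim-z = proj₁ (proj₂ (section-dim z))

  -- Scatteredness and the distance of the dual code.

  -- If k-1 such vectors were dependent over L, their L-span would fit in a subspace of dimension
  -- k-2, which would then meet `U` in too many K-independent vectors.
  scattered⇒indep : Scattered U k' → (u : Fin (suc k') → Fin k → Carrier) → (∀ i → U (u i)) →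
    LinIndep (Vsp k) In u → ¬ DVL.Dependent u
  scattered⇒indep scattered u u∈ u-ind dep =
    let v , v-ind , span⊆span = DVL.extend-to (λ v → Span (Vsp k) AllL basis ⊆ Span (Vsp k) AllL v)
          {W = λ _ → ⊤}
          (λ {_} {v} x _ ⊆v p → DVL.span-weaken {v = x ∷ v} (⊆v p))
          -- The rank over L is below k-1, so the basis can be enlarged, with standard basis vectors
          -- of L^k, to length exactly k-2.
          (ℕ.s≤s⁻¹ (dependent⇒rank< dep)) (ℕ.m≤n+m k' 2)
          (Rank.std F full , (λ _ → tt) , Rank.std-indep F full)
          basis-indep (λ p → p)
    in scattered (Span (Vsp k) AllL v) (DVL.span-isSubspace v)
         (DVL.basis⇒dim {W = Span (Vsp k) AllL v} (DVL.generator∈span v) v-ind (λ p → p))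
         (u , (λ i → u∈ i , span⊆span (generators⊆span-basis i)) , u-ind)
    where
    open RVL.RankData (RVL.rankData u)

  -- A dual codeword of weight below k would give, by its rank factorisation, fewer than k vectors
  -- of `U` that are independent over K and dependent over L. Padding them with vectors of `U` to
  -- exactly k-1 keeps both properties and contradicts `scattered⇒indep`.
  scattered⇒k≤weight : Scattered U k' → ∀ {y} → Dual (Code G) y → NonZero y → k ℕ.≤ weight y
  scattered⇒k≤weight scattered {y} y∈ y≢0 with k ℕ.≤? weight y
  ... | yes p = p
  ... | no ¬p =
      let v , v-ind , v∈ , v-dep = DVK.extend-to (λ v → (∀ i → U (v i)) × DVL.Dependent v) {W = U}
            (λ x x∈ (v∈ , dep) → (λ { zero → x∈ ; (suc i) → v∈ i }) , DVL.dependent-∷ x dep)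
            (≡.subst (ℕ._≤ suc k') (hasRankWeight-unique y span-dim) (ℕ.s≤s⁻¹ (ℕ.≰⇒> ¬p))) (ℕ.<⇒≤ k≤n) U-hasIndep
            (DVK.combinations-indep columns-indep coord-In coord-indep)
            ((λ i → coord i , coord-In i , λ _ → refl) , u-dep)
      in ⊥-elim (scattered⇒indep scattered v v∈ v-ind v-dep)
    where
    open RK.RankData (RK.rankData y)
    u : Fin rank → Fin k → Carrier
    u i = lincomb (Vsp k) (coord i) g
    basis≢0 : ∃ λ i → ¬ (basis i ≈ 0#)
    basis≢0 = Fin.¬∀⟶∃¬ rank _ (λ i → basis i ≟ 0#) (λ z → y≢0 (λ j → trans (factorisation j)
      (trans (LL.lincomb-congʳ z) (LL.lincomb-zeroʳ (λ i → coord i j)))))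
    u-dep : DVL.Dependent u
    -- Combining the `u i` with the factors `basis i` reassembles the sum of the columns of `G`
    -- weighted by `y`, which vanishes because `y` is in the dual.
    u-dep = basis , (λ _ → tt) , (λ i → trans (CV.lincomb-assoc basis coord g i)
      (trans (CV.lincomb-congˡ {v = g} (λ j → trans (eval-lincomb basis coord j)
               (trans (lincomb-swap basis (λ i → coord i j)) (sym (factorisation j)))) i)
        (Equivalence.from (columns⊥⇔Dual G y) y∈ i))) , basis≢0

  -- Vectors with entries in a k-dimensional K-subspace of L form an nk-dimensional space, on which
  -- the k parity checks impose km < nk conditions over K.
  dual-light-codeword : ∃ λ y → Dual (Code G) y × NonZero y × weight y ℕ.≤ k
  dual-light-codeword =
    let b , _ , b-ind = DL.hasIndep-≤ {W = λ _ → ⊤} k≤m (proj₁ degree)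
        B = Span Lsp In b
        0∈ , +∈ , ·∈ , resp∈ = DL.span-isSubspace b
        v , v∈ , v-ind = DVK.hasIndep-≤ {W = (λ y → ∀ j → B (y j)) ∩ Rows⊥ G} 1≤kρ
          (hasIndep-∩-rows⊥ {W = λ y → ∀ j → B (y j)}
            ((λ j → 0∈) , (λ p q j → +∈ (p j) (q j)) , (λ c∈ p j → ·∈ c∈ (p j)) ,
              (λ e p j → resp∈ (e j) (p j))) G
            (≡.subst (HasIndep (Vsp n) In (λ y → ∀ j → B (y j))) nk≡km+kρ
              (Rank.hasIndep-product F K {W = B} 0∈ n (b , DL.generator∈span b , b-ind))))
    in v zero , rows⊥⇒Dual (proj₂ (v∈ zero)) ,
       (λ z → 0≉1 (sym (v-ind (λ _ → 1#) (λ _ → has1)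
         (λ j → trans (+-identityʳ _) (trans (*-identityˡ _) (z j))) zero))) ,
       weight≤ (v zero) b (proj₁ (v∈ zero))

  scattered⇒minDist : Scattered U k' → HasMinDist (Dual (Code G)) k
  scattered⇒minDist scattered =
    (let y , y∈ , y≢0 , w≤k = dual-light-codeword in
      y , y∈ , y≢0 , ≡.subst (HasRankWeight y)
        (ℕ.≤-antisym w≤k (scattered⇒k≤weight scattered y∈ y≢0)) (hasRankWeight y)) ,
    λ y w y∈ y≢0 y-weight → ≡.subst (k ℕ.≤_) (hasRankWeight-unique y y-weight)
      (scattered⇒k≤weight scattered y∈ y≢0)

  -- If scatteredness failed at `T`, there would be k-1 K-independent vectors of `U` in `T`,
  -- dependent over L with coefficients `α`. Combining their K-coordinate rows `M` with `α` gives a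
  -- dual codeword whose entries lie in the K-span of k-1 elements, so its weight is below k.
  minDist⇒scattered : (∀ y w → Dual (Code G) y → NonZero y → HasRankWeight y w → k ℕ.≤ w) →
    Scattered U k'
  minDist⇒scattered minimal T T-sub (_ , T-dim≤) (u , u∈ , u-ind)
    with DVL.¬indep⇒dependent {v = u} (λ ind → T-dim≤ (u , (λ i → proj₂ (u∈ i)) , ind))
  ... | α , _ , relation , i , αᵢ≉0 =
      ℕ.1+n≰n (ℕ.≤-trans (minimal y _ y∈ y≢0 (hasRankWeight y)) (weight≤ y α y∈span))
    where
    M : Fin (suc k') → Fin n → Carrier
    M i = proj₁ (proj₁ (u∈ i))
    M∈ : ∀ i j → In (M i j)
    M∈ i = proj₁ (proj₂ (proj₁ (u∈ i)))
    u≈ : ∀ i j → u i j ≈ lincomb (Vsp k) (M i) g j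
    u≈ i = proj₂ (proj₂ (proj₁ (u∈ i)))
    combine : ∀ c j → lincomb (Vsp k) c u j ≈ lincomb (Vsp k) (lincomb (Vsp n) c M) g j
    combine c j = trans (CV.lincomb-congʳ {c = c} u≈ j) (CV.lincomb-assoc c M g j)
    M-ind : LinIndep (Vsp n) In M
    M-ind c c∈ e = u-ind c c∈ (λ j → trans (combine c j)
      (trans (CV.lincomb-congˡ {v = g} e j) (CV.lincomb-zeroˡ g j)))
    y : Fin n → Carrier
    y = lincomb (Vsp n) α M
    y∈ : Dual (Code G) y
    y∈ = Equivalence.to (columns⊥⇔Dual G y) (λ j → trans (sym (combine α j)) (relation j))
    y≢0 : NonZero y
    -- The rows `M` have entries in K and are independent over K, hence over L, so a nontrivial
    -- combination of them is nonzero.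
    y≢0 y≈0 = αᵢ≉0 (indepK⇒indepL M∈ M-ind α (λ _ → tt) y≈0 i)
    y∈span : ∀ j → Span Lsp In α (y j)
    y∈span j = (λ i → M i j) , (λ i → M∈ i j) ,
      trans (eval-lincomb α M j) (lincomb-swap α (λ i → M i j))

  -- The length and divisibility conditions of `QuasiMRD` hold for these parameters, so the content
  -- is the minimum distance.
  code-quasiMRD⇔eps : QuasiMRD (Code G) k ⇔ IsEps U (suc k') (+ ρ)
  code-quasiMRD⇔eps = mk⇔
    (λ (_ , _ , d) → minDist⇒eps (≡.subst (HasMinDist (Code G)) dist-code d))
    (λ e → m<n , n∤mk , ≡.subst (HasMinDist (Code G)) (≡.sym dist-code) (eps⇒minDist e))

  dual-quasiMRD⇔scattered : QuasiMRD (Dual (Code G)) (n ℕ.∸ k) ⇔ Scattered U k'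
  dual-quasiMRD⇔scattered = mk⇔
    (λ (_ , _ , d) → minDist⇒scattered (proj₂ (≡.subst (HasMinDist (Dual (Code G))) dist-dual d)))
    (λ s → m<n , n∤m[n∸k] ,
      ≡.subst (HasMinDist (Dual (Code G))) (≡.sym dist-dual) (scattered⇒minDist s))

  dually-quasiMRD⇔ : DuallyQuasiMRD (Code G) k ⇔ (Scattered U k' × IsEps U (suc k') (+ ρ))
  dually-quasiMRD⇔ = mk⇔
    (λ (c , d) → Equivalence.to dual-quasiMRD⇔scattered d , Equivalence.to code-quasiMRD⇔eps c)
    (λ (s , e) → Equivalence.from code-quasiMRD⇔eps e , Equivalence.from dual-quasiMRD⇔scattered s)

open import Data.Nat using (_+_; _*_; _∸_; _≤_; _<_)

theorem2p20 : (F : Field) (K : Over.Subfield F) (m : ℕ) →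
  Over.Codes.IsDegree F K m →
  (k ρ : ℕ) → 2 ≤ k → 1 ≤ ρ → ρ * (k ∸ 1) < m →
  (G : Fin k → Fin (m + ρ) → Field.Carrier F) →
  Over.LinIndep F (Over.Vsp F (m + ρ)) (Over.AllL F) G →
  Over.Codes.ColumnsIndepK F K m G →
  Over.Codes.NonDegenerate F K m (Over.Codes.Dual F K m (Over.Codes.Code F K m G)) ((m + ρ) ∸ k) →
  ((Over.Codes.QuasiMRD F K m (Over.Codes.Code F K m G) k
     ⇔ Over.Codes.IsEps F K m (Over.Codes.System F K m G) (k ∸ 1) (+ ρ))
  × (Over.Codes.QuasiMRD F K m (Over.Codes.Dual F K m (Over.Codes.Code F K m G)) ((m + ρ) ∸ k)
     ⇔ Over.Codes.Scattered F K m (Over.Codes.System F K m G) (k ∸ 2))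
  × (Over.Codes.DuallyQuasiMRD F K m (Over.Codes.Code F K m G) k
     ⇔ (Over.Codes.Scattered F K m (Over.Codes.System F K m G) (k ∸ 2)
        × Over.Codes.IsEps F K m (Over.Codes.System F K m G) (k ∸ 1) (+ ρ))))
-- Writing k as k'+2 lets `k ∸ 1` and `k ∸ 2` compute to `suc k'` and `k'`.
theorem2p20 F K m degree (suc (suc k')) ρ (ℕ.s≤s (ℕ.s≤s _)) 1≤ρ ρk<m G rows-indep columns-indep _ =
    code-quasiMRD⇔eps , dual-quasiMRD⇔scattered , dually-quasiMRD⇔
  where open RankMetricCode F K m degree k' ρ 1≤ρ ρk<m G rows-indep columns-indep
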